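{- For every weak composition $a$, $\mathcal{A}_a=\mathfrak{Q}^{(1)}_a$.
   Context: A weak composition of length $n$ is a sequence of $n$ nonnegative integers. $D(a)$: $a_i$ left-justified boxes in row $i$, row 1 lowest. For a filling $S$, $x^{\mathrm{wt}(S)}=\prod_i x_i^{\#\{\text{entries } i\}}$. Demazure atom: a triple of $D(a)$ (rows $r<s$) is Type A: boxes $\gamma=(r,c),\alpha=(r,c+1),\beta=(s,c+1)$ with $a_r\ge a_s$, or Type B: $\gamma=(s,c),\alpha=(s,c+1),\beta=(r,c)$ with $a_s>a_r$; inversion triple if $\beta>\gamma\ge\alpha$ or $\gamma\ge\alpha>\beta$. $\mathcal{A}_a=\sum x^{\mathrm{wt}(S)}$ over fillings of $D(a)$ with positive integers, rows weakly decreasing left to right, distinct entries in each column, all triples inversion triples, and first-column entry of each nonempty row $i$ equal to $i$. Quasi-key tableau of shape $a$: filling of $D(a)$ with positive integers such that (1) entries weakly decrease along rows and no entry of row $i$ exceeds $i$; (2) entries in each column are distinct and increase going up the first column; (3) if an entry $i$ is above an entry $k$ in the same column with $i<k$, there is an entry $j$ immediately right of $k$ with $i<j$; (4) for two rows with the higher row strictly longer, if $i$ is in column $c$ of the lower row and $j$ in column $c+1$ of the higher row, then $i<j$. $\mathfrak{Q}^{(1)}_a=\sum x^{\mathrm{wt}(T)}$ over quasi-key tableaux $T$ of shape $a$ whose first-column entries equal their row indices. -}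

module Defs where

open import Data.Bool.Base using (if_then_else_)
open import Data.Fin.Base as Fin using (Fin; toℕ)
open import Data.Fin.Properties using (all?; any?; toℕ<n)
  renaming (_<?_ to _<ᶠ?_)
open import Data.Integer.Base as ℤ using (ℤ; 0ℤ; 1ℤ)
open import Data.List.Base as List using (List; []; _∷_; _++_; [_])
open import Data.List.Membership.Propositional using (_∈_)
open import Data.List.Membership.Propositional.Properties
  using (∈-cartesianProductWith⁺; ∈-applyUpTo⁺; ∈-filter⁺; ∈-filter⁻)
open import Data.List.Relation.Unary.AllPairs using () renaming ([] to []ᵖ; _∷_ to _∷ᵖ_)
open import Data.List.Relation.Unary.All using () renaming ([] to []ᵃ)
open import Data.List.Relation.Unary.Any using (here)
open import Data.List.Relation.Unary.Unique.Propositional using (Unique)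
open import Data.List.Relation.Unary.Unique.Propositional.Properties
  using (cartesianProductWith⁺; filter⁺; applyUpTo⁺₁)
open import Data.Nat.Base using (ℕ; zero; suc; _≤_; _<_; _≥_; _>_; s≤s; z≤n)
open import Data.Nat.Properties
  using (_≟_; _≤?_; _<?_; _≥?_; _>?_; ≤-trans; ≤-reflexive; suc-injective; <⇒≢)
open import Data.Product.Base using (_×_; _,_; proj₂; ∃)
open import Data.Sum.Base using (_⊎_)
open import Data.Vec.Base as Vec using (Vec; []; _∷_; lookup)
open import Data.Vec.Properties using (≡-dec; ∷-injective)
open import Data.Vec.Relation.Unary.All as All using (All; []; _∷_)
open import Data.Vec.Relation.Unary.All.Properties using (lookup⁺)
open import Function.Base using (_∘_)
open import Relation.Binary.PropositionalEquality using (_≡_; _≢_; refl)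
open import Relation.Nullary.Decidable
  using (Dec; map′; does; _×-dec_; _⊎-dec_; _→-dec_; ¬?)
open import Relation.Unary using (Pred; Decidable)
open import Level using (0ℓ)

private
  variable
    n : ℕ

Monomial : ℕ → Set
Monomial n = Vec ℕ n

-- Formal sums of terms in x₁, …, xₙ with integer coefficients; two of
-- them are the same polynomial when all their coefficients agree (_≈_).
Polynomial : ℕ → Set
Polynomial n = List (ℤ × Monomial n)

coeff : Polynomial n → Monomial n → ℤ
coeff []            e = 0ℤ
coeff ((k , d) ∷ p) e =
  (if does (≡-dec _≟_ d e) then k else 0ℤ) ℤ.+ coeff p e

infix 4 _≈_

_≈_ : Polynomial n → Polynomial n → Set
p ≈ q = ∀ e → coeff p e ≡ coeff q e

x^_ : Monomial n → Polynomial n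
x^ e = [ 1ℤ , e ]

∑ : {A : Set} → List A → (A → Polynomial n) → Polynomial n
∑ xs f = List.concatMap f xs

WeakComposition : ℕ → Set
WeakComposition n = Vec ℕ n

-- The component at i : Fin n is row i + 1 of the diagram D(a), read from left
-- to right (row 1 is the lowest).  Columns are also indexed from 0.
Filling : WeakComposition n → Set
Filling a = All (Vec ℕ) a

Column : WeakComposition n → Fin n → Set
Column a r = Fin (lookup a r)

infix 8 _⟨_,_⟩

_⟨_,_⟩ : {a : WeakComposition n} → Filling a → (r : Fin n) → Column a r → ℕ
T ⟨ r , c ⟩ = lookup (lookup⁺ T r) c

row# : Fin n → ℕ
row# r = suc (toℕ r)

entries : {a : WeakComposition n} → Filling a → List ℕ
entries []        = []
entries (row ∷ T) = Vec.toList row ++ entries T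

-- The exponent of xᵢ is the number of entries i.  Only x₁, …, xₙ are recorded:
-- in the fillings summed below no entry exceeds n (atom-bounded,
-- quasiKey¹-bounded).
wt : {a : WeakComposition n} → Filling a → Monomial n
wt T = Vec.tabulate λ i → List.length (List.filter (_≟ row# i) (entries T))

-- In the conditions below on two rows, r is the lower and s the higher row.

module _ {a : WeakComposition n} (T : Filling a) where

  Positive : Set
  Positive = ∀ r c → 1 ≤ T ⟨ r , c ⟩

  RowsWeaklyDecrease : Set
  RowsWeaklyDecrease = ∀ r (c c′ : Column a r) → c Fin.< c′ →
    T ⟨ r , c ⟩ ≥ T ⟨ r , c′ ⟩

  ColumnsDistinct : Set
  ColumnsDistinct = ∀ r s → r Fin.< s →
    (c : Column a r) (d : Column a s) → toℕ c ≡ toℕ d →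
    T ⟨ r , c ⟩ ≢ T ⟨ s , d ⟩

  FirstColumnIsRowIndex : Set
  FirstColumnIsRowIndex = ∀ r (c : Column a r) → toℕ c ≡ 0 → T ⟨ r , c ⟩ ≡ row# r

InversionTriple : (γ α β : ℕ) → Set
InversionTriple γ α β = (β > γ × γ ≥ α) ⊎ (γ ≥ α × α > β)

module _ {a : WeakComposition n} (T : Filling a) where

  TypeATriplesInverted : Set
  TypeATriplesInverted = ∀ r s → r Fin.< s → lookup a r ≥ lookup a s →
    (γ α : Column a r) (β : Column a s) → toℕ α ≡ suc (toℕ γ) → toℕ β ≡ suc (toℕ γ) →
    InversionTriple (T ⟨ r , γ ⟩) (T ⟨ r , α ⟩) (T ⟨ s , β ⟩)

  TypeBTriplesInverted : Set
  TypeBTriplesInverted = ∀ r s → r Fin.< s → lookup a s > lookup a r →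
    (γ α : Column a s) (β : Column a r) → toℕ α ≡ suc (toℕ γ) → toℕ β ≡ toℕ γ →
    InversionTriple (T ⟨ s , γ ⟩) (T ⟨ s , α ⟩) (T ⟨ r , β ⟩)

  -- Triples consist of boxes of D(a) only; no basement column is added.
  record IsAtomFilling : Set where
    constructor mkAtom
    field
      positive           : Positive T
      rowsWeaklyDecrease : RowsWeaklyDecrease T
      columnsDistinct    : ColumnsDistinct T
      typeA              : TypeATriplesInverted
      typeB              : TypeBTriplesInverted
      firstColumn        : FirstColumnIsRowIndex T

  RowBounded : Set
  RowBounded = ∀ r c → T ⟨ r , c ⟩ ≤ row# r

  FirstColumnIncreases : Set
  FirstColumnIncreases = ∀ r s → r Fin.< s →
    (c : Column a r) (d : Column a s) → toℕ c ≡ 0 → toℕ d ≡ 0 →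
    T ⟨ r , c ⟩ < T ⟨ s , d ⟩

  ColumnInversionsWitnessed : Set
  ColumnInversionsWitnessed = ∀ r s → r Fin.< s →
    (c : Column a r) (d : Column a s) → toℕ c ≡ toℕ d →
    T ⟨ s , d ⟩ < T ⟨ r , c ⟩ →
    ∃ λ (c′ : Column a r) → toℕ c′ ≡ suc (toℕ c) × T ⟨ s , d ⟩ < T ⟨ r , c′ ⟩

  LongerHigherRowsDominate : Set
  LongerHigherRowsDominate = ∀ r s → r Fin.< s → lookup a s > lookup a r →
    (c : Column a r) (d : Column a s) → toℕ d ≡ suc (toℕ c) →
    T ⟨ r , c ⟩ < T ⟨ s , d ⟩

  record IsQuasiKeyTableau : Set where
    constructor mkQuasiKey
    field
      positive                  : Positive T
      rowsWeaklyDecrease        : RowsWeaklyDecrease T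
      rowBounded                : RowBounded
      columnsDistinct           : ColumnsDistinct T
      firstColumnIncreases      : FirstColumnIncreases
      columnInversionsWitnessed : ColumnInversionsWitnessed
      longerHigherRowsDominate  : LongerHigherRowsDominate

  IsQuasiKeyTableau¹ : Set
  IsQuasiKeyTableau¹ = IsQuasiKeyTableau × FirstColumnIsRowIndex T

module _ {a : WeakComposition n} (T : Filling a) where

  positive? : Dec (Positive T)
  positive? = all? λ r → all? λ c → 1 ≤? T ⟨ r , c ⟩

  rowsWeaklyDecrease? : Dec (RowsWeaklyDecrease T)
  rowsWeaklyDecrease? = all? λ r → all? λ c → all? λ c′ →
    (c <ᶠ? c′) →-dec (T ⟨ r , c ⟩ ≥? T ⟨ r , c′ ⟩)

  columnsDistinct? : Dec (ColumnsDistinct T)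
  columnsDistinct? = all? λ r → all? λ s → (r <ᶠ? s) →-dec
    (all? λ c → all? λ d → (toℕ c ≟ toℕ d) →-dec ¬? (T ⟨ r , c ⟩ ≟ T ⟨ s , d ⟩))

  firstColumnIsRowIndex? : Dec (FirstColumnIsRowIndex T)
  firstColumnIsRowIndex? = all? λ r → all? λ c →
    (toℕ c ≟ 0) →-dec (T ⟨ r , c ⟩ ≟ row# r)

  inversionTriple? : ∀ γ α β → Dec (InversionTriple γ α β)
  inversionTriple? γ α β = (β >? γ ×-dec γ ≥? α) ⊎-dec (γ ≥? α ×-dec α >? β)

  typeA? : Dec (TypeATriplesInverted T)
  typeA? = all? λ r → all? λ s → (r <ᶠ? s) →-dec (lookup a r ≥? lookup a s) →-dec
    (all? λ γ → all? λ α → all? λ β →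
      (toℕ α ≟ suc (toℕ γ)) →-dec (toℕ β ≟ suc (toℕ γ)) →-dec
      inversionTriple? (T ⟨ r , γ ⟩) (T ⟨ r , α ⟩) (T ⟨ s , β ⟩))

  typeB? : Dec (TypeBTriplesInverted T)
  typeB? = all? λ r → all? λ s → (r <ᶠ? s) →-dec (lookup a s >? lookup a r) →-dec
    (all? λ γ → all? λ α → all? λ β →
      (toℕ α ≟ suc (toℕ γ)) →-dec (toℕ β ≟ toℕ γ) →-dec
      inversionTriple? (T ⟨ s , γ ⟩) (T ⟨ s , α ⟩) (T ⟨ r , β ⟩))

  isAtomFilling? : Dec (IsAtomFilling T)
  isAtomFilling? = map′
    (λ (p , w , d , tA , tB , f) → mkAtom p w d tA tB f)
    (λ (mkAtom p w d tA tB f) → p , w , d , tA , tB , f)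
    (positive? ×-dec rowsWeaklyDecrease? ×-dec columnsDistinct? ×-dec
     typeA? ×-dec typeB? ×-dec firstColumnIsRowIndex?)

  rowBounded? : Dec (RowBounded T)
  rowBounded? = all? λ r → all? λ c → T ⟨ r , c ⟩ ≤? row# r

  firstColumnIncreases? : Dec (FirstColumnIncreases T)
  firstColumnIncreases? = all? λ r → all? λ s → (r <ᶠ? s) →-dec
    (all? λ c → all? λ d → (toℕ c ≟ 0) →-dec (toℕ d ≟ 0) →-dec
      (T ⟨ r , c ⟩ <? T ⟨ s , d ⟩))

  columnInversionsWitnessed? : Dec (ColumnInversionsWitnessed T)
  columnInversionsWitnessed? = all? λ r → all? λ s → (r <ᶠ? s) →-dec
    (all? λ c → all? λ d → (toℕ c ≟ toℕ d) →-dec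
      (T ⟨ s , d ⟩ <? T ⟨ r , c ⟩) →-dec
      (any? λ c′ → (toℕ c′ ≟ suc (toℕ c)) ×-dec (T ⟨ s , d ⟩ <? T ⟨ r , c′ ⟩)))

  longerHigherRowsDominate? : Dec (LongerHigherRowsDominate T)
  longerHigherRowsDominate? = all? λ r → all? λ s → (r <ᶠ? s) →-dec
    (lookup a s >? lookup a r) →-dec
    (all? λ c → all? λ d → (toℕ d ≟ suc (toℕ c)) →-dec
      (T ⟨ r , c ⟩ <? T ⟨ s , d ⟩))

  isQuasiKeyTableau? : Dec (IsQuasiKeyTableau T)
  isQuasiKeyTableau? = map′
    (λ (p , w , b , d , f , i , l) → mkQuasiKey p w b d f i l)
    (λ (mkQuasiKey p w b d f i l) → p , w , b , d , f , i , l)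
    (positive? ×-dec rowsWeaklyDecrease? ×-dec rowBounded? ×-dec columnsDistinct? ×-dec
     firstColumnIncreases? ×-dec columnInversionsWitnessed? ×-dec longerHigherRowsDominate?)

  isQuasiKeyTableau¹? : Dec (IsQuasiKeyTableau¹ T)
  isQuasiKeyTableau¹? = isQuasiKeyTableau? ×-dec firstColumnIsRowIndex?

-- A duplicate-free list of exactly the elements satisfying P.
record Enumeration {A : Set} (P : Pred A 0ℓ) : Set where
  field
    elements : List A
    unique   : Unique elements
    sound    : ∀ {x} → x ∈ elements → P x
    complete : ∀ {x} → P x → x ∈ elements

open Enumeration

module _ (m : ℕ) where

  BoundedEntries : {a : WeakComposition n} → Filling a → Set
  BoundedEntries T = ∀ r c → 1 ≤ T ⟨ r , c ⟩ × T ⟨ r , c ⟩ ≤ m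

  oneUpTo : List ℕ
  oneUpTo = List.applyUpTo suc m

  ∈-oneUpTo : ∀ {k} → 1 ≤ k × k ≤ m → k ∈ oneUpTo
  ∈-oneUpTo {suc k} (_ , k<m) = ∈-applyUpTo⁺ suc k<m

  rows : ∀ k → List (Vec ℕ k)
  rows zero    = [ [] ]
  rows (suc k) = List.cartesianProductWith _∷_ oneUpTo (rows k)

  rows-unique : ∀ k → Unique (rows k)
  rows-unique zero    = []ᵃ ∷ᵖ []ᵖ
  rows-unique (suc k) = cartesianProductWith⁺ _∷_ ∷-injective
    (applyUpTo⁺₁ suc m λ i<j _ eq → <⇒≢ i<j (suc-injective eq)) (rows-unique k)

  rows-complete : ∀ {k} (v : Vec ℕ k) → (∀ c → 1 ≤ lookup v c × lookup v c ≤ m) → v ∈ rows k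
  rows-complete []      h = here refl
  rows-complete (x ∷ v) h =
    ∈-cartesianProductWith⁺ _∷_ (∈-oneUpTo (h Fin.zero)) (rows-complete v (h ∘ Fin.suc))

  fillings : (a : WeakComposition n) → List (Filling a)
  fillings []      = [ [] ]
  fillings (k ∷ a) = List.cartesianProductWith _∷_ (rows k) (fillings a)

  fillings-unique : (a : WeakComposition n) → Unique (fillings a)
  fillings-unique []      = []ᵃ ∷ᵖ []ᵖ
  fillings-unique (k ∷ a) = cartesianProductWith⁺ _∷_ (λ { refl → refl , refl })
    (rows-unique k) (fillings-unique a)

  fillings-complete : {a : WeakComposition n} (T : Filling a) →
    BoundedEntries T → T ∈ fillings a
  fillings-complete []      h = here refl
  fillings-complete (v ∷ T) h = ∈-cartesianProductWith⁺ _∷_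
    (rows-complete v (h Fin.zero)) (fillings-complete T (h ∘ Fin.suc))

  enumerate : {a : WeakComposition n} {P : Pred (Filling a) 0ℓ} → Decidable P →
    (∀ {T} → P T → BoundedEntries T) → Enumeration P
  enumerate {a = a} P? bounded = record
    { elements = List.filter P? (fillings a)
    ; unique   = filter⁺ P? (fillings-unique a)
    ; sound    = proj₂ ∘ ∈-filter⁻ P? {xs = fillings a}
    ; complete = λ {T} p → ∈-filter⁺ P? (fillings-complete T (bounded p)) p
    }

row-bounded : {a : WeakComposition n} (T : Filling a) →
  RowsWeaklyDecrease T → FirstColumnIsRowIndex T → RowBounded T
row-bounded {a = a} T dec first r = go (dec r) (first r)
  where
  go : ∀ {k} {t : Fin k → ℕ} →
    (∀ c c′ → c Fin.< c′ → t c ≥ t c′) → (∀ c → toℕ c ≡ 0 → t c ≡ row# r) →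
    ∀ c → t c ≤ row# r
  go d f Fin.zero    = ≤-reflexive (f Fin.zero refl)
  go d f (Fin.suc c) =
    ≤-trans (d Fin.zero (Fin.suc c) (s≤s z≤n)) (≤-reflexive (f Fin.zero refl))

atom-bounded : {a : WeakComposition n} {T : Filling a} →
  IsAtomFilling T → BoundedEntries n T
atom-bounded {T = T} p r c = positive r c ,
  ≤-trans (row-bounded T rowsWeaklyDecrease firstColumn r c) (toℕ<n r)
  where open IsAtomFilling p

quasiKey¹-bounded : {a : WeakComposition n} {T : Filling a} →
  IsQuasiKeyTableau¹ T → BoundedEntries n T
quasiKey¹-bounded (q , _) r c = positive r c , ≤-trans (rowBounded r c) (toℕ<n r)
  where open IsQuasiKeyTableau q

atomFillings : (a : WeakComposition n) → Enumeration (IsAtomFilling {a = a})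
atomFillings {n} a = enumerate n isAtomFilling? atom-bounded

quasiKeyTableaux¹ : (a : WeakComposition n) → Enumeration (IsQuasiKeyTableau¹ {a = a})
quasiKeyTableaux¹ {n} a = enumerate n isQuasiKeyTableau¹? quasiKey¹-bounded

𝒜 : WeakComposition n → Polynomial n
𝒜 a = ∑ (elements (atomFillings a)) λ S → x^ wt S

𝔔¹ : WeakComposition n → Polynomial n
𝔔¹ a = ∑ (elements (quasiKeyTableaux¹ a)) λ T → x^ wt T

{-# OPTIONS --safe #-}

-- The two sets of fillings differ, but in both of them a filling is determined by
-- its column sets.  Let the entries of a column be cars and the entries of the column to
-- its left be spots, each car taking the first free spot that is at least its
-- size; the set of occupied spots does not depend on the order of arrival.
-- Parking the entries of column d successively in columns d - 1, ..., 0 yields a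
-- subset of the first column, the key of column d.  A choice of column sets
-- comes from a filling of shape a if and only if the key of column d is the set of
-- rows longer than d, and this holds for both kinds of filling:
-- * in a quasi-key tableau, for every ℓ, the entries of column d + 1 in the rows
--   longer than ℓ ≥ d + 1 park exactly on the entries of column d in the same rows;
-- * in an atom filling, the key of the entries ≥ v of column d is the set of rows
--   with an entry ≥ v there.  When v occurs in column d + 1, lowering the
--   threshold from v + 1 to v adds to the key of column d + 1 the least element
--   that is in the key of the entries ≥ v of column d and not yet in it, and the
--   triple conditions say that v sits in the corresponding row.
-- So passing to the filling of the other kind with the same column sets is a
-- weight-preserving bijection.

module Submission where

open import Defs
open import Algebra.Properties.CommutativeMonoid.Sum as Sum using ()
open import Data.Bool.Base using (Bool; true; false; not; _∧_; if_then_else_)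
open import Data.Bool.Properties using (∧-zeroʳ)
open import Data.Fin.Base as Fin using (Fin; toℕ; fromℕ<)
open import Data.Fin.Properties using (toℕ<n; toℕ-fromℕ<; toℕ-injective) renaming (_≟_ to _≟ᶠ_)
open import Data.Integer.Base as ℤ using (ℤ; 0ℤ; 1ℤ)
import Data.Integer.Properties as ℤ
open import Algebra.Properties.CommutativeSemigroup ℤ.+-commutativeSemigroup using (x∙yz≈y∙xz)
open import Data.List.Base using (List; []; _∷_; _++_; length; filter; map)
open import Data.List.Membership.Propositional using (_∈_)
open import Data.List.Membership.Propositional.Properties using (∈-map⁺; ∈-map⁻)
open import Data.List.Membership.Propositional.Properties.WithK using (unique∧set⇒bag)
open import Data.List.Properties
  using (filter-++; filter-accept; filter-reject; length-++; map-∘; map-id-local)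
open import Data.List.Relation.Binary.BagAndSetEquality using (∼bag⇒↭)
open import Data.List.Relation.Binary.Permutation.Propositional as ↭ using (_↭_)
import Data.List.Relation.Unary.All as Listᵃ
open import Data.List.Relation.Unary.Any using (here; there)
open import Data.List.Relation.Unary.Unique.Propositional using (Unique)
import Data.List.Relation.Unary.Unique.Propositional.Properties as Unique
open import Data.Nat.Base
  using (ℕ; zero; suc; _+_; _∸_; _⊓_; _≤_; _<_; _<ᵇ_; _≤ᵇ_; z≤n; s≤s)
open import Data.Nat.Properties
open import Algebra.Properties.CommutativeSemigroup +-commutativeSemigroup using (interchange)
open import Data.Product.Base using (_×_; _,_; proj₁; proj₂; ∃; map₁; map₂)
open import Data.Sum.Base using (_⊎_; inj₁; inj₂; [_,_]′)
open import Data.Vec.Base using (Vec; []; _∷_; lookup; tabulate; toList)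
open import Data.Vec.Properties using (tabulate-cong; ≡-dec)
open import Data.Vec.Relation.Unary.All using ([]; _∷_)
open import Data.Vec.Relation.Unary.All.Properties using (lookup⁺)
open import Function.Base using (_∘_; id; case_of_)
open import Function.Bundles using (mk⇔)
open import Level using (0ℓ)
open import Relation.Binary.Definitions using (tri<; tri≈; tri>)
open import Relation.Binary.PropositionalEquality
  using (_≡_; _≢_; _≗_; refl; sym; trans; cong; cong₂; subst; subst₂; module ≡-Reasoning)
open import Relation.Nullary using (¬_; contradiction)
open import Relation.Nullary.Decidable
  using (Dec; yes; no; does; dec-true; dec-false; _×-dec_; decidable-stable)
open import Relation.Unary using (Pred; Decidable)

open Sum +-0-commutativeMonoid using (sum; sum-cong-≗; ∑-distrib-+)

private
  variable
    P Q R : Set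

-- Counting

𝟙 : Dec P → ℕ
𝟙 (yes _) = 1
𝟙 (no  _) = 0

𝟙-yes : (p? : Dec P) → P → 𝟙 p? ≡ 1
𝟙-yes (yes _) _ = refl
𝟙-yes (no ¬p) p = contradiction p ¬p

𝟙-no : (p? : Dec P) → ¬ P → 𝟙 p? ≡ 0
𝟙-no (yes p) ¬p = contradiction p ¬p
𝟙-no (no _)  _  = refl

𝟙-witness : (p? : Dec P) → 0 < 𝟙 p? → P
𝟙-witness (yes p) _ = p

𝟙-mono : (p? : Dec P) (q? : Dec Q) → (P → Q) → 𝟙 p? ≤ 𝟙 q?
𝟙-mono (yes p) q? f = ≤-reflexive (sym (𝟙-yes q? (f p)))
𝟙-mono (no _)  q? f = z≤n

𝟙-cong : (p? : Dec P) (q? : Dec Q) → (P → Q) → (Q → P) → 𝟙 p? ≡ 𝟙 q?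
𝟙-cong p? q? f g = ≤-antisym (𝟙-mono p? q? f) (𝟙-mono q? p? g)

𝟙-split : (p? : Dec P) (q? : Dec Q) (r? : Dec R) →
  (P → Q ⊎ R) → (Q → P) → (R → P) → ¬ (Q × R) → 𝟙 p? ≡ 𝟙 q? + 𝟙 r?
𝟙-split p? (yes q) (yes r) f g h d = contradiction (q , r) d
𝟙-split p? (yes q) (no ¬r) f g h d = 𝟙-yes p? (g q)
𝟙-split p? (no ¬q) (yes r) f g h d = 𝟙-yes p? (h r)
𝟙-split p? (no ¬q) (no ¬r) f g h d = 𝟙-no p? ([ ¬q , ¬r ]′ ∘ f)

sum-mono-≤ : ∀ {n} {f g : Fin n → ℕ} → (∀ i → f i ≤ g i) → sum f ≤ sum g
sum-mono-≤ {zero}  f≤g = z≤n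
sum-mono-≤ {suc n} f≤g = +-mono-≤ (f≤g Fin.zero) (sum-mono-≤ (f≤g ∘ Fin.suc))

sum-zero : ∀ {n} {f : Fin n → ℕ} → (∀ i → f i ≡ 0) → sum f ≡ 0
sum-zero {zero}  f≡0 = refl
sum-zero {suc n} f≡0 = cong₂ _+_ (f≡0 Fin.zero) (sum-zero (f≡0 ∘ Fin.suc))

sum-term-≤ : ∀ {n} (f : Fin n → ℕ) i → f i ≤ sum f
sum-term-≤ f Fin.zero    = m≤m+n _ _
sum-term-≤ f (Fin.suc i) = ≤-trans (sum-term-≤ (f ∘ Fin.suc) i) (m≤n+m _ _)

sum-witness : ∀ {n} (f : Fin n → ℕ) → 0 < sum f → ∃ λ i → 0 < f i
sum-witness {suc n} f 0<Σ with f Fin.zero in eq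
... | suc _ = Fin.zero , subst (0 <_) (sym eq) (s≤s z≤n)
... | zero  = let i , 0<fi = sum-witness (f ∘ Fin.suc) 0<Σ in Fin.suc i , 0<fi

sum-strict : ∀ {n} {f g : Fin n → ℕ} → (∀ i → f i ≤ g i) → ∀ i → f i < g i → sum f < sum g
sum-strict f≤g Fin.zero    fi<gi = +-mono-<-≤ fi<gi (sum-mono-≤ (f≤g ∘ Fin.suc))
sum-strict f≤g (Fin.suc i) fi<gi = +-mono-≤-< (f≤g Fin.zero) (sum-strict (f≤g ∘ Fin.suc) i fi<gi)

module _ {n} {P : Pred (Fin n) 0ℓ} (P? : Decidable P) where

  # : ℕ
  # = sum (𝟙 ∘ P?)

  #-none : (∀ r → ¬ P r) → # ≡ 0
  #-none ¬P = sum-zero λ r → 𝟙-no (P? r) (¬P r)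

  #-some : ∀ {r} → P r → 0 < #
  #-some {r} p = ≤-trans (≤-reflexive (sym (𝟙-yes (P? r) p))) (sum-term-≤ (𝟙 ∘ P?) r)

  #-witness : 0 < # → ∃ P
  #-witness 0<# = let r , 0<𝟙 = sum-witness (𝟙 ∘ P?) 0<# in r , 𝟙-witness (P? r) 0<𝟙

#-≤1 : ∀ {n} {P : Pred (Fin n) 0ℓ} (P? : Decidable P) →
  (∀ {r s} → r Fin.< s → P r → ¬ P s) → # P? ≤ 1
#-≤1 {zero}  P? unique = z≤n
#-≤1 {suc n} P? unique with P? Fin.zero
... | yes p₀ = s≤s (≤-reflexive (#-none (P? ∘ Fin.suc) λ r → unique (s≤s z≤n) p₀))
... | no  _  = #-≤1 (P? ∘ Fin.suc) λ r<s → unique (s≤s r<s)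

module _ {n} {P Q : Pred (Fin n) 0ℓ} (P? : Decidable P) (Q? : Decidable Q) where

  #-mono : (∀ {r} → P r → Q r) → # P? ≤ # Q?
  #-mono P⊆Q = sum-mono-≤ λ r → 𝟙-mono (P? r) (Q? r) P⊆Q

  #-strict : (∀ {r} → P r → Q r) → ∀ {r} → Q r → ¬ P r → # P? < # Q?
  #-strict P⊆Q {r} q ¬p = sum-strict (λ s → 𝟙-mono (P? s) (Q? s) P⊆Q) r
    (≤-reflexive (trans (cong suc (𝟙-no (P? r) ¬p)) (sym (𝟙-yes (Q? r) q))))

  #-exhausts : (∀ {r} → P r → Q r) → # Q? ≤ # P? → ∀ {r} → Q r → P r
  #-exhausts P⊆Q #Q≤#P {r} q =
    decidable-stable (P? r) λ ¬p → <⇒≱ (#-strict P⊆Q q ¬p) #Q≤#P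

#-≤1-unique : ∀ {n} {P : Pred (Fin n) 0ℓ} (P? : Decidable P) → # P? ≤ 1 →
  ∀ {r s} → P r → P s → r ≡ s
#-≤1-unique {P = P} P? #≤1 {r} {s} pr ps = decidable-stable (r ≟ᶠ s) λ r≢s → <⇒≱
  (≤-<-trans (#-some (_≟ᶠ r) refl)
    (#-strict (_≟ᶠ r) P? (λ { refl → pr }) ps (r≢s ∘ sym)))
  #≤1

#-cong : ∀ {n} {P Q : Pred (Fin n) 0ℓ} (P? : Decidable P) (Q? : Decidable Q) →
  (∀ {r} → P r → Q r) → (∀ {r} → Q r → P r) → # P? ≡ # Q?
#-cong P? Q? P⊆Q Q⊆P = ≤-antisym (#-mono P? Q? P⊆Q) (#-mono Q? P? Q⊆P)

#-split : ∀ {n} {P Q R : Pred (Fin n) 0ℓ}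
  (P? : Decidable P) (Q? : Decidable Q) (R? : Decidable R) →
  (∀ {r} → P r → Q r ⊎ R r) → (∀ {r} → Q r → P r) → (∀ {r} → R r → P r) →
  (∀ {r} → ¬ (Q r × R r)) → # P? ≡ # Q? + # R?
#-split P? Q? R? f g h d = trans
  (sum-cong-≗ λ r → 𝟙-split (P? r) (Q? r) (R? r) f g h d)
  (∑-distrib-+ (𝟙 ∘ Q?) (𝟙 ∘ R?))

-- Bags of natural numbers and their prefix counts

Bag : Set
Bag = ℕ → ℕ

below : Bag → ℕ → ℕ
below B zero    = 0
below B (suc u) = below B u + B u

below-mono : ∀ {B B′} m → (∀ v → v < m → B v ≤ B′ v) → below B m ≤ below B′ m
below-mono zero    B≤B′ = z≤n
below-mono (suc m) B≤B′ =
  +-mono-≤ (below-mono m λ v v<m → B≤B′ v (m≤n⇒m≤1+n v<m)) (B≤B′ m ≤-refl)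

below-monoʳ : ∀ B {u v} → u ≤ v → below B u ≤ below B v
below-monoʳ B {v = zero}  z≤n = z≤n
below-monoʳ B {u} {suc v} u≤1+v with m≤n⇒m<n∨m≡n u≤1+v
... | inj₁ (s≤s u≤v) = ≤-trans (below-monoʳ B u≤v) (m≤m+n _ _)
... | inj₂ refl      = ≤-refl

below-+ : ∀ B B′ m → below (λ v → B v + B′ v) m ≡ below B m + below B′ m
below-+ B B′ zero    = refl
below-+ B B′ (suc m) = trans (cong (_+ (B m + B′ m)) (below-+ B B′ m))
  (interchange (below B m) (below B′ m) (B m) (B′ m))

below-cong : ∀ {B B′} m → (∀ v → v < m → B v ≡ B′ v) → below B m ≡ below B′ m
below-cong zero    B≡B′ = refl
below-cong (suc m) B≡B′ =
  cong₂ _+_ (below-cong m λ v v<m → B≡B′ v (m≤n⇒m≤1+n v<m)) (B≡B′ m ≤-refl)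

below-term : ∀ B {v m} → v < m → B v ≤ below B m
below-term B {v} v<m = ≤-trans (m≤n+m (B v) (below B v)) (below-monoʳ B v<m)

-- A strict inequality anywhere would make the totals differ. For contents of equal total, only one
-- inclusion then needs a proof.
below-squeeze : ∀ {B B′} m → (∀ v → v < m → B v ≤ B′ v) → below B′ m ≤ below B m →
  ∀ v → v < m → B v ≡ B′ v
below-squeeze {B} {B′} (suc m) B≤B′ Σ′≤Σ v v<1+m with m≤n⇒m<n∨m≡n v<1+m
... | inj₁ (s≤s v<m) = below-squeeze m (λ w w<m → B≤B′ w (m≤n⇒m≤1+n w<m))
        (+-cancelʳ-≤ (B m) _ _ (≤-trans (+-monoʳ-≤ (below B′ m) (B≤B′ m ≤-refl)) Σ′≤Σ)) v v<m
... | inj₂ refl = ≤-antisym (B≤B′ m ≤-refl) (+-cancelˡ-≤ (below B m) _ _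
        (≤-trans (+-monoˡ-≤ (B′ m) (below-mono m λ w w<m → B≤B′ w (m≤n⇒m≤1+n w<m))) Σ′≤Σ))

below-suc : ∀ B m → below B (suc m) ≡ B 0 + below (B ∘ suc) m
below-suc B zero    = sym (+-identityʳ (B 0))
below-suc B (suc m) = trans (cong (_+ B (suc m)) (below-suc B m)) (+-assoc (B 0) _ _)

sum≡below : ∀ B n → sum {n} (B ∘ toℕ) ≡ below B n
sum≡below B zero    = refl
sum≡below B (suc n) =
  trans (cong (B 0 +_) (sum≡below (B ∘ suc) n)) (sym (below-suc B n))

-- As `Q` is downward closed, the counted numbers form an initial segment and the count is its end
-- point. An entry can therefore be defined as a count and read back through the numbers `u` below
-- it.
below-initial : {Q : Pred ℕ 0ℓ} (Q? : Decidable Q) → (∀ u → Q (suc u) → Q u) →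
  ∀ m {u} → (u < below (𝟙 ∘ Q?) m → u < m × Q u) × (u < m → Q u → u < below (𝟙 ∘ Q?) m)
below-initial {Q} Q? down = λ m → to m , from m
  where
  down-≤ : ∀ {u v} → u ≤ v → Q v → Q u
  down-≤ {v = zero}  z≤n q = q
  down-≤ {u} {suc v} u≤1+v q with m≤n⇒m<n∨m≡n u≤1+v
  ... | inj₁ (s≤s u≤v) = down-≤ u≤v (down v q)
  ... | inj₂ refl      = q
  all-below : ∀ m → (∀ v → v < m → Q v) → below (𝟙 ∘ Q?) m ≡ m
  all-below zero    all = refl
  all-below (suc m) all = trans
    (cong₂ _+_ (all-below m λ v v<m → all v (m≤n⇒m≤1+n v<m)) (𝟙-yes (Q? m) (all m ≤-refl)))
    (+-comm m 1)
  to : ∀ m {u} → u < below (𝟙 ∘ Q?) m → u < m × Q u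
  to (suc m) {u} u<b with Q? m
  ... | no _  = map₁ m≤n⇒m≤1+n (to m (subst (u <_) (+-identityʳ _) u<b))
  ... | yes q with u≤m ← ≤-pred (subst (u <_)
          (trans (cong (_+ 1) (all-below m λ v v<m → down-≤ (<⇒≤ v<m) q)) (+-comm m 1)) u<b)
          = s≤s u≤m , down-≤ u≤m q
  from : ∀ m {u} → u < m → Q u → u < below (𝟙 ∘ Q?) m
  from m {u} u<m q = subst (_≤ below (𝟙 ∘ Q?) m)
    (all-below (suc u) λ v v<1+u → down-≤ (≤-pred v<1+u) q) (below-monoʳ (𝟙 ∘ Q?) u<m)

module _ {n} {P : Pred (Fin n) 0ℓ} (P? : Decidable P) where

  tally : (Fin n → ℕ) → Bag
  tally f v = # λ r → P? r ×-dec (f r ≟ v)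

  #< : (Fin n → ℕ) → ℕ → ℕ
  #< f u = # λ r → P? r ×-dec (f r <? u)

  rank : Fin n → ℕ
  rank r = #< toℕ (toℕ r)

  below-tally : ∀ f u → below (tally f) u ≡ #< f u
  below-tally f zero    = sym (#-none (λ r → P? r ×-dec (f r <? 0)) λ r → λ ())
  below-tally f (suc u) = trans (cong (_+ tally f u) (below-tally f u)) (sym
    (#-split (λ r → P? r ×-dec (f r <? suc u)) (λ r → P? r ×-dec (f r <? u)) (λ r → P? r ×-dec (f r ≟ u))
      (λ (p , f<1+u) → [ inj₁ ∘ (p ,_) ∘ ≤-pred , inj₂ ∘ (p ,_) ∘ suc-injective ]′
        (m≤n⇒m<n∨m≡n f<1+u))
      (map₂ m≤n⇒m≤1+n) (map₂ λ { refl → ≤-refl })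
      (λ ((_ , f<u) , (_ , f≡u)) → <⇒≢ f<u f≡u)))

  -- On P the values of f appear in increasing order, so the value at r is the
  -- one preceded by exactly rank r others.
  <⇒#<≤rank : ∀ f → (∀ {r s} → r Fin.< s → P r → P s → f r ≤ f s) →
    ∀ {r u} → P r → u < f r → #< f (suc u) ≤ rank r
  <⇒#<≤rank f incr {r} {u} p u<fr = #-mono
    (λ s → P? s ×-dec (f s <? suc u)) (λ s → P? s ×-dec (toℕ s <? toℕ r))
    λ {s} (ps , fs≤u) → ps , ≰⇒> λ r≤s → case m≤n⇒m<n∨m≡n r≤s of λ where
      (inj₁ r<s) → <⇒≱ u<fr (≤-trans (incr r<s p ps) (≤-pred fs≤u))
      (inj₂ r≡s) → <⇒≱ u<fr (subst (λ x → f x ≤ u) (sym (toℕ-injective r≡s)) (≤-pred fs≤u))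

  #<≤rank⇒< : ∀ f → (∀ {r s} → r Fin.< s → P r → P s → f r ≤ f s) →
    ∀ {r u} → P r → #< f (suc u) ≤ rank r → u < f r
  #<≤rank⇒< f incr {r} {u} p #≤rank = ≰⇒> λ fr≤u → <⇒≱
    (#-strict (λ s → P? s ×-dec (toℕ s <? toℕ r)) (λ s → P? s ×-dec (f s <? suc u))
      (λ (ps , s<r) → ps , s≤s (≤-trans (incr s<r ps p) fr≤u))
      (p , s≤s fr≤u) (n≮n (toℕ r) ∘ proj₂))
    #≤rank

#-rank< : ∀ {n} {P : Pred (Fin n) 0ℓ} (P? : Decidable P) m →
  # (λ r → P? r ×-dec (rank P? r <? m)) ≡ m ⊓ # P?
#-rank< {zero}  P? m = sym (⊓-zeroʳ m)
#-rank< {suc n} {P} P? m = trans (cong₂ _+_ head-term tail-term) (go (P? Fin.zero) m)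
  where
  P?′ = P? ∘ Fin.suc
  rank-zero : rank P? Fin.zero ≡ 0
  rank-zero = #-none (λ s → P? s ×-dec (toℕ s <? 0)) λ s → λ ()
  rank-suc : ∀ r → rank P? (Fin.suc r) ≡ 𝟙 (P? Fin.zero) + rank P?′ r
  rank-suc r = cong₂ _+_
    (𝟙-cong (P? Fin.zero ×-dec (0 <? suc (toℕ r))) (P? Fin.zero) proj₁ (_, s≤s z≤n))
    (#-cong (λ s → P?′ s ×-dec (suc (toℕ s) <? suc (toℕ r))) (λ s → P?′ s ×-dec (toℕ s <? toℕ r))
      (map₂ ≤-pred) (map₂ s≤s))
  head-term : 𝟙 (P? Fin.zero ×-dec (rank P? Fin.zero <? m)) ≡ 𝟙 (P? Fin.zero ×-dec (0 <? m))
  head-term = cong (λ x → 𝟙 (P? Fin.zero ×-dec (x <? m))) rank-zero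
  tail-term : # (λ r → P?′ r ×-dec (rank P? (Fin.suc r) <? m)) ≡
              # (λ r → P?′ r ×-dec (𝟙 (P? Fin.zero) + rank P?′ r <? m))
  tail-term = sum-cong-≗ λ r → cong (λ x → 𝟙 (P?′ r ×-dec (x <? m))) (rank-suc r)
  -- Ranks run through 0, 1, 2, ... along `P`: a first row in `P` takes rank 0 and raises every
  -- later rank by one.
  go : (p? : Dec (P Fin.zero)) → ∀ m →
    𝟙 (p? ×-dec (0 <? m)) + # (λ r → P?′ r ×-dec (𝟙 p? + rank P?′ r <? m)) ≡ m ⊓ (𝟙 p? + # P?′)
  go (no  _) m       = #-rank< P?′ m
  go (yes _) zero    = #-none (λ r → P?′ r ×-dec (suc (rank P?′ r) <? 0)) λ r → λ ()
  go (yes _) (suc m) = cong suc (trans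
    (#-cong (λ r → P?′ r ×-dec (suc (rank P?′ r) <? suc m)) (λ r → P?′ r ×-dec (rank P?′ r <? m))
      (map₂ ≤-pred) (map₂ s≤s))
    (#-rank< P?′ m))

-- Parking

module _ (C : Bag) where

  -- Cars of sizes D (with multiplicity) drive up the line of spots C and each
  -- takes the first free spot at or above its size; load counts the cars
  -- that drive past.
  load : Bag → Bag
  load D zero    = 0
  load D (suc v) = (load D v + D v) ∸ C v

  park : Bag → Bag
  park D v = C v ⊓ (load D v + D v)

  -- Conservation of cars: a car of size less than `u` has either parked before `u` or is still
  -- driving when it reaches `u`.
  below-park : ∀ D u → below (park D) u + load D u ≡ below D u
  below-park D zero    = refl
  below-park D (suc u) = begin
    below (park D) u + park D u + (load D u + D u ∸ C u)   ≡⟨ +-assoc (below (park D) u) _ _ ⟩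
    below (park D) u + (park D u + (load D u + D u ∸ C u)) ≡⟨ cong (below (park D) u +_) (m⊓n+n∸m≡n (C u) _) ⟩
    below (park D) u + (load D u + D u)                    ≡⟨ +-assoc (below (park D) u) _ _ ⟨
    below (park D) u + load D u + D u                      ≡⟨ cong (_+ D u) (below-park D u) ⟩
    below D u + D u                                        ∎
    where open ≡-Reasoning

  park≤ : ∀ D v → park D v ≤ C v
  park≤ D v = m⊓n≤m _ _

  load-mono : ∀ {D E} → (∀ v → D v ≤ E v) → ∀ v → load D v ≤ load E v
  load-mono D≤E zero    = z≤n
  load-mono D≤E (suc v) = ∸-monoˡ-≤ (C v) (+-mono-≤ (load-mono D≤E v) (D≤E v))

  park-mono : ∀ {D E} → (∀ v → D v ≤ E v) → ∀ v → park D v ≤ park E v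
  park-mono D≤E v = ⊓-monoʳ-≤ (C v) (+-mono-≤ (load-mono D≤E v) (D≤E v))

  load-cong : ∀ {D E} → D ≗ E → load D ≗ load E
  load-cong D≗E zero    = refl
  load-cong D≗E (suc v) = cong (_∸ C v) (cong₂ _+_ (load-cong D≗E v) (D≗E v))

  park-cong : ∀ {D E} → D ≗ E → park D ≗ park E
  park-cong D≗E v = cong (C v ⊓_) (cong₂ _+_ (load-cong D≗E v) (D≗E v))

  module _ {D : Bag} {t} (D≡0 : ∀ v → v < t → D v ≡ 0) where

    load-zero : ∀ v → v ≤ t → load D v ≡ 0
    load-zero zero    _   = refl
    load-zero (suc v) v<t = trans
      (cong (_∸ C v) (cong₂ _+_ (load-zero v (<⇒≤ v<t)) (D≡0 v v<t))) (0∸n≡0 (C v))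

    park-zero : ∀ v → v < t → park D v ≡ 0
    park-zero v v<t = trans
      (cong (C v ⊓_) (cong₂ _+_ (load-zero v (<⇒≤ v<t)) (D≡0 v v<t))) (⊓-zeroʳ (C v))

-- grow D E is D plus one copy of the least v with D v < E v.
fresh : Bag → Bag → ℕ → Bool
fresh D E zero    = true
fresh D E (suc v) = fresh D E v ∧ not (D v <ᵇ E v)

grow : Bag → Bag → Bag
grow D E v = if fresh D E v ∧ (D v <ᵇ E v) then suc (D v) else D v

<ᵇ-true : ∀ {m n} → m < n → (m <ᵇ n) ≡ true
<ᵇ-true m<n = dec-true (_ <? _) m<n

<ᵇ-false : ∀ {m n} → n ≤ m → (m <ᵇ n) ≡ false
<ᵇ-false n≤m = dec-false (_ <? _) (≤⇒≯ n≤m)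

fresh-true : ∀ D E v → (∀ u → u < v → E u ≤ D u) → fresh D E v ≡ true
fresh-true D E zero    E≤D = refl
fresh-true D E (suc v) E≤D
  rewrite fresh-true D E v (λ u u<v → E≤D u (m≤n⇒m≤1+n u<v)) | <ᵇ-false (E≤D v ≤-refl) = refl

fresh-false : ∀ D E {u v} → u < v → D u < E u → fresh D E v ≡ false
fresh-false D E {u} {suc v} u<1+v D<E with m≤n⇒m<n∨m≡n u<1+v
... | inj₁ (s≤s u<v) rewrite fresh-false D E u<v D<E = refl
... | inj₂ refl      rewrite <ᵇ-true D<E = ∧-zeroʳ (fresh D E v)

module _ {D E : Bag} {x} (E≤D : ∀ u → u < x → E u ≤ D u) (Dx<Ex : D x < E x) where

  grow-at : grow D E x ≡ suc (D x)
  grow-at rewrite fresh-true D E x E≤D | <ᵇ-true Dx<Ex = refl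

  grow-off : ∀ {u} → u ≢ x → grow D E u ≡ D u
  grow-off {u} u≢x with <-cmp u x
  ... | tri< u<x _ _ rewrite fresh-true D E u (λ w w<u → E≤D w (<-trans w<u u<x))
                           | <ᵇ-false (E≤D u u<x) = refl
  ... | tri≈ _ u≡x _ = contradiction u≡x u≢x
  ... | tri> _ _ x<u rewrite fresh-false D E x<u Dx<Ex = refl

module _ {D D′ E E′ : Bag} (D≗D′ : D ≗ D′) (E≗E′ : E ≗ E′) where

  fresh-cong : fresh D E ≗ fresh D′ E′
  fresh-cong zero    = refl
  fresh-cong (suc v) rewrite fresh-cong v | D≗D′ v | E≗E′ v = refl

  grow-cong : grow D E ≗ grow D′ E′
  grow-cong v rewrite fresh-cong v | D≗D′ v | E≗E′ v = refl

grew-first : ∀ D E {x} → D x < grow D E x → ∀ u → u < x → E u ≤ D u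
grew-first D E {x} D<G u u<x with D u <? E u
... | no D≮E  = ≮⇒≥ D≮E
... | yes D<E rewrite fresh-false D E u<x D<E = contradiction D<G (n≮n (D x))

grew⇒< : ∀ D E {x} → D x < grow D E x → D x < E x
grew⇒< D E {x} D<G with D x <? E x
... | yes D<E = D<E
... | no D≮E rewrite <ᵇ-false (≮⇒≥ D≮E) | ∧-zeroʳ (fresh D E x) = contradiction D<G (n≮n (D x))

-- The extra car of grow D E either has not started (equal), is still driving
-- (driving), or has parked (parked).  The arguments are the loads, or the cars
-- present at a spot, for D, grow D E and E, and whether D ⊂ E and
-- park D ⊂ park E have not been told apart yet.
data Progress : (d g e : ℕ) (f f′ : Bool) → Set where
  equal   : ∀ {d} → Progress d d d true true
  driving : ∀ {d e} → suc d ≤ e → Progress d (suc d) e false true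
  parked  : ∀ {d e} → d ≤ e → Progress d d e false false

module _ (C : Bag) {D E : Bag} (D≤E : ∀ v → D v ≤ E v) where

  private
    G = grow D E
    D′ = park C D
    E′ = park C E

    arrive : ∀ {d g e f f′} v → f ≡ fresh D E v → Progress d g e f f′ →
      Progress (d + D v) (g + G v) (e + E v) (fresh D E (suc v)) f′
    arrive v eq (driving d<e) rewrite sym eq = driving (+-mono-≤ d<e (D≤E v))
    arrive v eq (parked d≤e)  rewrite sym eq = parked (+-mono-≤ d≤e (D≤E v))
    arrive {d} v eq equal with m≤n⇒m<n∨m≡n (D≤E v)
    ... | inj₁ D<E rewrite sym eq | <ᵇ-true D<E | +-suc d (D v) =
            driving (≤-trans (≤-reflexive (sym (+-suc d (D v)))) (+-monoʳ-≤ d D<E))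
    ... | inj₂ D≡E rewrite sym eq | D≡E | <ᵇ-false {E v} ≤-refl = equal

    serve : ∀ {d g e f f′} c → Progress d g e f f′ →
      Progress (d ∸ c) (g ∸ c) (e ∸ c) f (f′ ∧ not (c ⊓ d <ᵇ c ⊓ e)) ×
      c ⊓ g ≡ (if f′ ∧ (c ⊓ d <ᵇ c ⊓ e) then suc (c ⊓ d) else c ⊓ d)
    serve {d} c equal rewrite <ᵇ-false {c ⊓ d} ≤-refl = equal , refl
    serve {d} {e = e} c (driving d<e) with c ≤? d
    ... | yes c≤d rewrite m≤n⇒m⊓n≡m c≤d | m≤n⇒m⊓n≡m (≤-trans c≤d (<⇒≤ d<e))
                        | <ᵇ-false {c} ≤-refl | m≤n⇒m⊓n≡m (m≤n⇒m≤1+n c≤d) | +-∸-assoc 1 c≤d =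
            driving (≤-trans (≤-reflexive (sym (+-∸-assoc 1 c≤d))) (∸-monoˡ-≤ c d<e)) , refl
    -- The spot is not full for `D`, so the extra car parks here. As `E` has at least one more car
    -- waiting, this is also where `park C D` and `park C E` first differ.
    ... | no c≰d rewrite <ᵇ-true (<-≤-trans (s≤s (m⊓n≤n c d)) (⊓-glb (≰⇒> c≰d) d<e))
                       | m≥n⇒m⊓n≡n (≰⇒> c≰d) | m≥n⇒m⊓n≡n (<⇒≤ (≰⇒> c≰d))
                       | m≤n⇒m∸n≡0 (≰⇒> c≰d) | m≤n⇒m∸n≡0 (<⇒≤ (≰⇒> c≰d)) =
            parked z≤n , refl
    serve c (parked d≤e) = parked (∸-monoˡ-≤ c d≤e) , refl

    progress : ∀ v → Progress (load C D v) (load C G v) (load C E v) (fresh D E v) (fresh D′ E′ v)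
    progress zero    = equal
    progress (suc v) = proj₁ (serve (C v) (arrive v refl (progress v)))

  -- The runs of `D` and `grow D E` differ by one extra car. It drives past a spot only if `D` alone
  -- already fills that spot, and there `park C D` and `park C E` agree; it stops at the first place
  -- where they differ.
  park-grow : park C (grow D E) ≗ grow (park C D) (park C E)
  park-grow v = proj₂ (serve (C v) (arrive v refl (progress v)))

-- Keys

from : ℕ → Bag → Bag
from t B v = if t ≤ᵇ v then B v else 0

from-≥ : ∀ {t v} B → t ≤ v → from t B v ≡ B v
from-≥ {t} {v} B t≤v rewrite dec-true (t ≤? v) t≤v = refl

from-< : ∀ {t v} B → v < t → from t B v ≡ 0
from-< {t} {v} B v<t rewrite dec-false (t ≤? v) (<⇒≱ v<t) = refl

from≤ : ∀ t B v → from t B v ≤ B v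
from≤ t B v with t ≤ᵇ v
... | true  = ≤-refl
... | false = z≤n

from-suc : ∀ {t v} B → v ≢ t → from t B v ≡ from (suc t) B v
from-suc {t} {v} B v≢t with <-cmp v t
... | tri< v<t _ _ = trans (from-< B v<t) (sym (from-< B (m≤n⇒m≤1+n v<t)))
... | tri≈ _ v≡t _ = contradiction v≡t v≢t
... | tri> _ _ t<v = trans (from-≥ B (<⇒≤ t<v)) (sym (from-≥ B t<v))

from-anti : ∀ t B v → from (suc t) B v ≤ from t B v
from-anti t B v with v ≟ t
... | yes refl = ≤-trans (≤-reflexive (from-< B (n<1+n t))) z≤n
... | no v≢t   = ≤-reflexive (sym (from-suc B v≢t))

-- For columns C c, the key of the entries ≥ t of column c + k in column c: park
-- them in column c + k - 1, what they occupy there in column c + k - 2, and so on.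
key : (ℕ → Bag) → (t c k : ℕ) → Bag
key C t c zero    = from t (C c)
key C t c (suc k) = park (C c) (key C t (suc c) k)

module _ (C : ℕ → Bag) where

  key-zero : ∀ t c k v → v < t → key C t c k v ≡ 0
  key-zero t c zero    v v<t = from-< (C c) v<t
  key-zero t c (suc k) v v<t = park-zero (C c) (key-zero t (suc c) k) v v<t

  key≤ : ∀ t c k v → key C t c k v ≤ C c v
  key≤ t c zero    v = from≤ t (C c) v
  key≤ t c (suc k) v = park≤ (C c) _ v

  key-anti : ∀ t c k v → key C (suc t) c k v ≤ key C t c k v
  key-anti t c zero    = from-anti t (C c)
  key-anti t c (suc k) = park-mono (C c) (key-anti t (suc c) k)

  -- Cars of size at least `t` park only at spots from `t` on, which settles `k = 0`; monotonicity
  -- of parking carries the inclusion to the left.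
  key-shrinks : ∀ t c k v → key C t c (suc k) v ≤ key C t c k v
  key-shrinks t c zero v with t ≤? v
  ... | yes t≤v = ≤-trans (key≤ t c 1 v) (≤-reflexive (sym (from-≥ (C c) t≤v)))
  ... | no  t≰v = ≤-trans (≤-reflexive (key-zero t c 1 v (≰⇒> t≰v))) z≤n
  key-shrinks t c (suc k) v = park-mono (C c) (key-shrinks t (suc c) k) v

  -- Cars only move upward or fail to park, so parking cannot raise a count below `u`.
  below-key : ∀ t c k u → below (key C t c (suc k)) u ≤ below (key C t (suc c) k) u
  below-key t c k u = ≤-trans (m≤m+n _ _) (≤-reflexive (below-park (C c) (key C t (suc c) k) u))

  key-skip : ∀ {t} c k → C (k + c) t ≡ 0 → key C t c k ≗ key C (suc t) c k
  key-skip {t} c zero Ct≡0 v with v ≟ t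
  ... | no v≢t   = from-suc (C c) v≢t
  ... | yes refl = trans (from-≥ (C c) (≤-refl {t})) (trans Ct≡0 (sym (from-< (C c) (n<1+n t))))
  key-skip {t} c (suc k) Ct≡0 =
    park-cong (C c) (key-skip (suc c) k (subst (λ d → C d t ≡ 0) (sym (+-suc k c)) Ct≡0))

  -- Lowering the threshold adds one car of size `t`. By `park-grow`, adding a least missing element
  -- persists from column to column. The inclusion that `park-grow` asks for is `key-anti` followed
  -- by `key-shrinks`.
  key-grow : ∀ {t} c k → C (suc k + c) t ≡ 1 →
    key C t c (suc k) ≗ grow (key C (suc t) c (suc k)) (key C t c k)
  key-grow {t} c zero Ct≡1 v = begin
    park (C c) (from t B) v                            ≡⟨ park-cong (C c) fromB v ⟩
    park (C c) (grow (from (suc t) B) E) v             ≡⟨ park-grow (C c) D≤E v ⟩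
    grow (park (C c) (from (suc t) B)) (park (C c) E) v ≡⟨ grow-cong (λ _ → refl) parkE v ⟩
    grow (park (C c) (from (suc t) B)) (from t (C c)) v ∎
    where
    open ≡-Reasoning
    B = C (suc c)
    D = from (suc t) B
    E₀ : Bag
    E₀ v = suc (D v + C c v)
    -- A crowd of cars filling every spot at or above t.
    E = from t E₀
    D≤E : ∀ v → D v ≤ E v
    D≤E v with t ≤? v
    ... | yes t≤v = ≤-trans (m≤n⇒m≤1+n (m≤m+n _ _)) (≤-reflexive (sym (from-≥ E₀ t≤v)))
    ... | no  t≰v = ≤-trans (≤-reflexive (from-< B (m≤n⇒m≤1+n (≰⇒> t≰v)))) z≤n
    E≤D : ∀ u → u < t → E u ≤ D u
    E≤D u u<t = ≤-trans (≤-reflexive (from-< E₀ u<t)) z≤n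
    Dt≡0 : D t ≡ 0
    Dt≡0 = from-< B (n<1+n t)
    Dt<Et : D t < E t
    Dt<Et = <-≤-trans (s≤s (m≤m+n _ _)) (≤-reflexive (sym (from-≥ E₀ (≤-refl {t}))))
    fromB : from t B ≗ grow D E
    fromB v with v ≟ t
    ... | no v≢t   = trans (from-suc B v≢t) (sym (grow-off E≤D Dt<Et v≢t))
    ... | yes refl = trans (trans (from-≥ B (≤-refl {t})) Ct≡1)
                       (sym (trans (grow-at E≤D Dt<Et) (cong suc Dt≡0)))
    parkE : park (C c) E ≗ from t (C c)
    parkE v with t ≤? v
    ... | no  t≰v = trans (park-zero (C c) (λ u → from-< E₀) v (≰⇒> t≰v)) (sym (from-< (C c) (≰⇒> t≰v)))
    ... | yes t≤v = trans
      (m≤n⇒m⊓n≡m (≤-trans (≤-trans (m≤n⇒m≤1+n (m≤n+m (C c v) (D v))) (≤-reflexive (sym (from-≥ E₀ t≤v))))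
                          (m≤n+m (E v) (load (C c) E v))))
      (sym (from-≥ (C c) t≤v))
  key-grow {t} c (suc k) Ct≡1 v = trans
    (park-cong (C c) (key-grow (suc c) k (subst (λ d → C d t ≡ 1) (cong suc (sym (+-suc k c))) Ct≡1)) v)
    (park-grow (C c) (λ u → ≤-trans (key-anti t (suc c) (suc k) u) (key-shrinks t (suc c) k u)) v)

module _ {C C′ : ℕ → Bag} (C≗C′ : ∀ c → C c ≗ C′ c) where

  key-congˡ : ∀ t c k → key C t c k ≗ key C′ t c k
  key-congˡ t c zero    v rewrite C≗C′ c v = refl
  key-congˡ t c (suc k) v = cong₂ _⊓_ (C≗C′ c v) (cong₂ _+_ (load≡ v) (key-congˡ t (suc c) k v))
    where
    load≡ : load (C c) (key C t (suc c) k) ≗ load (C′ c) (key C′ t (suc c) k)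
    load≡ zero    = refl
    load≡ (suc v) = cong₂ _∸_ (cong₂ _+_ (load≡ v) (key-congˡ t (suc c) k v)) (C≗C′ c v)

-- Grids

Grid : ℕ → Set
Grid n = Fin n → ℕ → ℕ

-- A filling extended by 0 outside the diagram with row lengths a.
record IsGrid {n} (a : Fin n → ℕ) (t : Grid n) : Set where
  field
    inside   : ∀ {r c} → c < a r → 0 < t r c
    outside  : ∀ {r c} → a r ≤ c → t r c ≡ 0
    dec      : ∀ r c → t r (suc c) ≤ t r c
    distinct : ∀ {r s} c → r Fin.< s → 0 < t r c → t r c ≢ t s c
    first    : ∀ {r} → 0 < a r → t r 0 ≡ row# r

  inside⁻¹ : ∀ {r c} → 0 < t r c → c < a r
  inside⁻¹ 0<t = ≰⇒> λ a≤c → <⇒≢ 0<t (sym (outside a≤c))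

  injective : ∀ {r s c} → 0 < t r c → t r c ≡ t s c → r ≡ s
  injective {r} {s} {c} 0<t tr≡ts with <-cmp (toℕ r) (toℕ s)
  ... | tri< r<s _ _ = contradiction tr≡ts (distinct c r<s 0<t)
  ... | tri≈ _ r≡s _ = toℕ-injective r≡s
  ... | tri> _ _ s<r = contradiction (sym tr≡ts) (distinct c s<r (subst (0 <_) tr≡ts 0<t))

  first≤ : ∀ r → t r 0 ≤ row# r
  first≤ r with 0 <? a r
  ... | yes 0<a = ≤-reflexive (first 0<a)
  ... | no  0≮a = ≤-trans (≤-reflexive (outside (≮⇒≥ 0≮a))) z≤n

  antitone : ∀ r {c c′} → c ≤ c′ → t r c′ ≤ t r c
  antitone r {c′ = zero}   z≤n = ≤-refl
  antitone r {c} {suc c′} c≤1+c′ with m≤n⇒m<n∨m≡n c≤1+c′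
  ... | inj₁ (s≤s c≤c′) = ≤-trans (dec r c′) (antitone r c≤c′)
  ... | inj₂ refl       = ≤-refl

  ≤row# : ∀ r c → t r c ≤ row# r
  ≤row# r c = ≤-trans (antitone r (z≤n {c})) (first≤ r)

  bounded : ∀ r c → t r c ≤ n
  bounded r c = ≤-trans (≤row# r c) (toℕ<n r)

-- Type A and type B triples at once: a missing box counts as an entry 0.
record IsAtomGrid {n} (a : Fin n → ℕ) (t : Grid n) : Set where
  field
    isGrid : IsGrid a t
    triple : ∀ {r s} c → r Fin.< s → 0 < t s (suc c) →
      t r c < t s (suc c) ⊎ t s (suc c) < t r (suc c)
  open IsGrid isGrid public

  -- Induction from the right end of row `r`. The second alternative of the triple would put
  -- `t r (suc c)` above `t s (suc c)`, but the next column gives `t r (suc c) < t s (suc (suc c)) ≤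
  -- t s (suc c)`; past the end of row `r` the entry 0 excludes it.
  dominates : ∀ {r s} c → r Fin.< s → a r < a s → c < a r → t r c < t s (suc c)
  dominates {r} {s} c r<s ar<as = go (a r) c (m≤m+n (a r) c)
    where
    go : ∀ j c → a r ≤ j + c → c < a r → t r c < t s (suc c)
    go zero    c ar≤c     c<ar = contradiction c<ar (≤⇒≯ ar≤c)
    go (suc j) c ar≤1+j+c c<ar with triple c r<s (inside (≤-<-trans c<ar ar<as))
    ... | inj₁ tr<ts = tr<ts
    ... | inj₂ ts<tr = contradiction ts<tr (<⇒≯ (<-≤-trans
            (go j (suc c) (≤-trans ar≤1+j+c (≤-reflexive (sym (+-suc j c))))
              (inside⁻¹ (≤-<-trans z≤n ts<tr)))
            (dec s (suc c))))

record IsKeyGrid {n} (a : Fin n → ℕ) (t : Grid n) : Set where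
  field
    isGrid    : IsGrid a t
    witnessed : ∀ {r s} c → r Fin.< s → 0 < t s c → t s c < t r c → t s c < t r (suc c)
    dominates : ∀ {r s} c → r Fin.< s → a r < a s → c < a r → t r c < t s (suc c)
  open IsGrid isGrid public

  -- Treats both vertical orders of the rows at once. If the longer row is higher, dominance
  -- contradicts the hypothesis; if it is lower, an inversion in column `c` would need a witness in
  -- the next column, which the hypothesis denies.
  no-crossing : ∀ {r s c} → a r < a s → c < a r → t s (suc c) ≤ t r c → t s c ≤ t r c
  no-crossing {r} {s} {c} ar<as c<ar ts≤tr with <-cmp (toℕ r) (toℕ s)
  ... | tri< r<s _ _ = contradiction ts≤tr (<⇒≱ (dominates c r<s ar<as c<ar))
  ... | tri≈ _ r≡s _ = ≤-reflexive (cong (λ x → t x c) (sym (toℕ-injective r≡s)))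
  ... | tri> _ _ s<r = ≮⇒≥ λ tr<ts → <⇒≱ (witnessed c s<r (inside c<ar) tr<ts) ts≤tr

  -- Through its witness, an inversion would force another one column further right, and so on past
  -- the end of both rows. The number `j` bounds the columns that remain.
  increasing : ∀ {r s} c → r Fin.< s → a r ≡ a s → t r c ≤ t s c
  increasing {r} {s} c r<s ar≡as = go (a r) c (m≤m+n (a r) c)
    where
    go : ∀ j c → a r ≤ j + c → t r c ≤ t s c
    go zero    c ar≤c = ≤-trans (≤-reflexive (outside ar≤c)) z≤n
    go (suc j) c ar≤1+j+c with c <? a s
    ... | no  c≮as = ≤-trans (≤-reflexive (outside (≤-trans (≤-reflexive ar≡as) (≮⇒≥ c≮as)))) z≤n
    ... | yes c<as = ≮⇒≥ λ ts<tr → <⇒≱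
            (<-≤-trans (witnessed c r<s (inside c<as) ts<tr)
              (go j (suc c) (≤-trans ar≤1+j+c (≤-reflexive (sym (+-suc j c))))))
            (dec s c)

-- Keys in the first column are computed at row numbers; together with 0 these exhaust the range up
-- to `n`.
row-induction : ∀ {n} (Q : ℕ → Set) → Q 0 → (∀ (r : Fin n) → Q (row# r)) → ∀ u → u ≤ n → Q u
row-induction Q q₀ qᵣ zero    _   = q₀
row-induction Q q₀ qᵣ (suc u) u<n = subst Q (cong suc (toℕ-fromℕ< u<n)) (qᵣ (fromℕ< u<n))

-- The contents of a grid

contents : ∀ {n} → (Fin n → ℕ) → Grid n → ℕ → Bag
contents a t c = tally (λ r → c <? a r) (λ r → t r c)

-- What the column sets of both kinds of filling have in common, and the input of both constructions
-- below. The field `shape` is the condition on keys.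
record IsContents {n} (a : Fin n → ℕ) (C : ℕ → Bag) : Set where
  field
    C≤1     : ∀ c v → C c v ≤ 1
    C-zero  : ∀ c → C c 0 ≡ 0
    C-large : ∀ c v → n < v → C c v ≡ 0
    total   : ∀ c → below (C c) (suc n) ≡ # (λ r → c <? a r)
    shape   : ∀ d r → key C 1 0 d (row# r) ≡ 𝟙 (d <? a r)

module GridContents {n} {a : Fin n → ℕ} {t : Grid n} (isGrid : IsGrid a t) where
  open IsGrid isGrid

  C = contents a t

  tally≤1 : ∀ c k v → tally (λ r → k + c <? a r) (λ r → t r c) v ≤ 1
  tally≤1 c k v = #-≤1 (λ r → (k + c <? a r) ×-dec (t r c ≟ v)) λ where
    r<s (k+c<a , refl) (_ , ts≡tr) →
      distinct c r<s (inside (≤-<-trans (m≤n+m c k) k+c<a)) (sym ts≡tr)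

  contents≤1 : ∀ c v → C c v ≤ 1
  contents≤1 c = tally≤1 c 0

  contents-zero : ∀ c → C c 0 ≡ 0
  contents-zero c = #-none (λ r → (c <? a r) ×-dec (t r c ≟ 0)) λ r (c<a , t≡0) →
    <⇒≢ (inside c<a) (sym t≡0)

  contents-large : ∀ c v → n < v → C c v ≡ 0
  contents-large c v n<v = #-none (λ r → (c <? a r) ×-dec (t r c ≟ v)) λ r (_ , t≡v) →
    <⇒≱ n<v (subst (_≤ n) t≡v (bounded r c))

  contents-total : ∀ c → below (C c) (suc n) ≡ # (λ r → c <? a r)
  contents-total c = trans (below-tally (λ r → c <? a r) (λ r → t r c) (suc n))
    (#-cong (λ r → (c <? a r) ×-dec (t r c <? suc n)) (λ r → c <? a r)
      proj₁ (λ {r} c<a → c<a , s≤s (bounded r c)))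

  first-column : ∀ d r → tally (λ r → d <? a r) (λ r → t r 0) (row# r) ≡ 𝟙 (d <? a r)
  first-column d r with d <? a r
  ... | yes d<a = ≤-antisym
          (≤-trans (#-mono Q? (λ r′ → (0 <? a r′) ×-dec (t r′ 0 ≟ row# r)) (map₁ (≤-<-trans z≤n)))
            (contents≤1 0 (row# r)))
          (#-some Q? (d<a , first (≤-<-trans z≤n d<a)))
    where Q? = λ r′ → (d <? a r′) ×-dec (t r′ 0 ≟ row# r)
  ... | no d≮a = #-none (λ r′ → (d <? a r′) ×-dec (t r′ 0 ≟ row# r)) λ r′ (d<a′ , t≡r) →
          d≮a (subst (λ x → d < a x)
            (toℕ-injective (suc-injective (trans (sym (first (≤-<-trans z≤n d<a′))) t≡r))) d<a′)

  isContents : (∀ d r → key C 1 0 d (row# r) ≡ 𝟙 (d <? a r)) → IsContents a C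
  isContents shape = record
    { C≤1 = contents≤1 ; C-zero = contents-zero ; C-large = contents-large
    ; total = contents-total ; shape = shape }

-- Keys of an atom grid

module AtomContents {n} {a : Fin n → ℕ} {t : Grid n} (isAtom : IsAtomGrid a t) where
  open IsAtomGrid isAtom
  open GridContents isGrid

  -- Outer induction on the column; inner induction on `v`, downward from values above `n`, where
  -- both sides vanish, with `j` counting the remaining steps. Passing from `suc v` to `v` changes
  -- neither side if `v` is absent from the column, and otherwise adds the same row to both.
  key-atom : ∀ d v r → 0 < v → key C v 0 d (row# r) ≡ 𝟙 (v ≤? t r d)
  key-atom zero v r 0<v with v ≤? t r 0
  ... | yes v≤t with 0<a ← inside⁻¹ (≤-trans 0<v v≤t) = trans
          (from-≥ (C 0) (≤-trans v≤t (first≤ r))) (trans (first-column 0 r) (𝟙-yes (0 <? a r) 0<a))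
  ... | no v≰t with v ≤? row# r
  ...   | no v≰r = from-< (C 0) (≰⇒> v≰r)
  ...   | yes v≤r = trans (from-≥ (C 0) v≤r) (trans (first-column 0 r)
            (𝟙-no (0 <? a r) λ 0<a → v≰t (subst (v ≤_) (sym (first 0<a)) v≤r)))
  key-atom (suc d) v r 0<v = go (suc n) v r 0<v (m≤n+m (suc n) v)
    where
    go : ∀ j v r → 0 < v → n < v + j → key C v 0 (suc d) (row# r) ≡ 𝟙 (v ≤? t r (suc d))
    go zero v r 0<v n<v+j with n<v ← subst (n <_) (+-identityʳ v) n<v+j = trans
      (key-zero C v 0 (suc d) (row# r) (≤-<-trans (toℕ<n r) n<v))
      (sym (𝟙-no (v ≤? t r (suc d)) (<⇒≱ (≤-<-trans (bounded r (suc d)) n<v))))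
    go (suc j) v r 0<v n<v+1+j = split (C (suc d + 0) v) refl
      where
      Q? = λ r → (suc d + 0 <? a r) ×-dec (t r (suc d + 0) ≟ v)
      d′ : suc d + 0 ≡ suc d
      d′ = +-identityʳ (suc d)
      IH : ∀ r → key C (suc v) 0 (suc d) (row# r) ≡ 𝟙 (suc v ≤? t r (suc d))
      IH r = go j (suc v) r (s≤s z≤n) (subst (n <_) (+-suc v j) n<v+1+j)
      unchanged : ∀ {r} → t r (suc d) ≢ v → 𝟙 (suc v ≤? t r (suc d)) ≡ 𝟙 (v ≤? t r (suc d))
      unchanged {r} t≢v =
        𝟙-cong (suc v ≤? t r (suc d)) (v ≤? t r (suc d)) <⇒≤ λ v≤t → ≤∧≢⇒< v≤t (t≢v ∘ sym)
      split : ∀ m → C (suc d + 0) v ≡ m → key C v 0 (suc d) (row# r) ≡ 𝟙 (v ≤? t r (suc d))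
      split zero eq = trans (key-skip C 0 (suc d) eq (row# r)) (trans (IH r)
        (unchanged λ t≡v → <⇒≢ (#-some Q?
          (subst (λ x → x < a r × t r x ≡ v) (sym d′) (inside⁻¹ (subst (0 <_) (sym t≡v) 0<v) , t≡v)))
          (sym eq)))
      split (suc (suc m)) eq =
        contradiction (subst (_≤ 1) eq (contents≤1 (suc d + 0) v)) λ where (s≤s ())
      split (suc zero) eq = let s , s-has = #-witness Q? (≤-reflexive (sym eq)) in
        hit s (subst (λ x → t s x ≡ v) d′ (proj₂ s-has))
        where
        D = key C (suc v) 0 (suc d)
        E = key C v 0 d
        hit : ∀ s → t s (suc d) ≡ v → key C v 0 (suc d) (row# r) ≡ 𝟙 (v ≤? t r (suc d))
        hit s refl = trans (key-grow C 0 d eq (row# r)) grown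
          where
          Ds≡0 : D (row# s) ≡ 0
          Ds≡0 = trans (IH s) (𝟙-no (suc v ≤? v) (n≮n v))
          Ds<Es : D (row# s) < E (row# s)
          Ds<Es = ≤-reflexive (trans (cong suc Ds≡0)
            (sym (trans (key-atom d v s 0<v) (𝟙-yes (v ≤? t s d) (dec s d)))))
          -- A row lower than `s` with an entry at least `v` in column `d` has, by its triple with
          -- `s`, an entry above `v` in the next column, so it is in `D` already. Hence `s` is the
          -- least missing row, the one that `grow` adds.
          E≤D : ∀ u → u < row# s → E u ≤ D u
          E≤D u u<s = row-induction (λ u → u < row# s → E u ≤ D u)
            (λ _ → ≤-trans (≤-reflexive (key-zero C v 0 d 0 0<v)) z≤n)
            (λ r r<s → subst₂ _≤_ (sym (key-atom d v r 0<v)) (sym (IH r))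
              (𝟙-mono (v ≤? t r d) (suc v ≤? t r (suc d)) λ v≤t →
                [ (λ t<v → contradiction v≤t (<⇒≱ t<v)) , id ]′ (triple d (≤-pred r<s) 0<v)))
            u (≤-trans (<⇒≤ u<s) (toℕ<n s)) u<s
          grown : grow D E (row# r) ≡ 𝟙 (v ≤? t r (suc d))
          grown with r ≟ᶠ s
          ... | yes refl = trans (grow-at E≤D Ds<Es)
                  (trans (cong suc Ds≡0) (sym (𝟙-yes (v ≤? v) ≤-refl)))
          ... | no r≢s = trans (grow-off E≤D Ds<Es (r≢s ∘ toℕ-injective ∘ suc-injective))
                  (trans (IH r) (unchanged λ tr≡v → r≢s (sym (injective 0<v (sym tr≡v)))))

  key-shape : ∀ d r → key C 1 0 d (row# r) ≡ 𝟙 (d <? a r)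
  key-shape d r = trans (key-atom d 1 r (s≤s z≤n))
    (𝟙-cong (1 ≤? t r d) (d <? a r) inside⁻¹ inside)

-- Keys of a quasi-key grid

module KeyContents {n} {a : Fin n → ℕ} {t : Grid n} (isKey : IsKeyGrid a t) where
  open IsKeyGrid isKey
  open GridContents isGrid

  module _ (c k : ℕ) where

    private
      Long? = λ r → suc k + c <? a r
      Mid?  = λ r → (c <? a r) ×-dec (a r ≤? suc k + c)
      t₀ t₁ : Fin n → ℕ
      t₀ r = t r c
      t₁ r = t r (suc c)
      -- Imagine the car of each long row driving to the spot of its own row: `Passing? v` selects
      -- those that come to `v` from smaller values, `Present? v` also those that start there.
      Passing? = λ v r → Long? r ×-dec ((t₁ r <? v) ×-dec (v ≤? t₀ r))
      Present? = λ v r → Long? r ×-dec ((t₁ r <? suc v) ×-dec (v ≤? t₀ r))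

      arrivals : ∀ v → # (Passing? v) + tally Long? t₁ v ≡ # (Present? v)
      arrivals v = sym (#-split (Present? v) (Passing? v) (λ r → Long? r ×-dec (t₁ r ≟ v))
        (λ (l , t₁≤v , v≤t₀) → [ (λ t₁<v → inj₁ (l , t₁<v , v≤t₀)) , (λ t₁≡v → inj₂ (l , t₁≡v)) ]′
          (m≤n⇒m<n∨m≡n (≤-pred t₁≤v)))
        (λ (l , t₁<v , v≤t₀) → l , m≤n⇒m≤1+n t₁<v , v≤t₀)
        (λ {r} (l , t₁≡v) → l , s≤s (≤-reflexive t₁≡v) , subst (_≤ t₀ r) t₁≡v (dec r c))
        (λ ((_ , t₁<v , _) , (_ , t₁≡v)) → <⇒≢ t₁<v t₁≡v))

      departures : ∀ v → # (Present? v) ≡ tally Long? t₀ v + # (Passing? (suc v))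
      departures v = #-split (Present? v) (λ r → Long? r ×-dec (t₀ r ≟ v)) (Passing? (suc v))
        (λ (l , t₁≤v , v≤t₀) → [ (λ v<t₀ → inj₂ (l , t₁≤v , v<t₀)) , (λ v≡t₀ → inj₁ (l , sym v≡t₀)) ]′
          (m≤n⇒m<n∨m≡n v≤t₀))
        (λ { {r} (l , refl) → l , s≤s (dec r c) , ≤-refl })
        (λ (l , t₁≤v , v<t₀) → l , t₁≤v , <⇒≤ v<t₀)
        (λ { ((_ , refl) , (_ , _ , v<t₀)) → n≮n _ v<t₀ })

      spots : ∀ v → C c v ≡ tally Long? t₀ v + tally Mid? t₀ v
      spots v = #-split (λ r → (c <? a r) ×-dec (t₀ r ≟ v))
        (λ r → Long? r ×-dec (t₀ r ≟ v)) (λ r → Mid? r ×-dec (t₀ r ≟ v))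
        (λ {r} (c<a , t₀≡v) → case suc k + c <? a r of λ where
          (yes l) → inj₁ (l , t₀≡v)
          (no ¬l) → inj₂ ((c<a , ≮⇒≥ ¬l) , t₀≡v))
        (map₁ (≤-<-trans (m≤n+m c (suc k)))) (map₁ proj₁)
        (λ ((l , _) , ((_ , ¬l) , _)) → <⇒≱ l ¬l)

      -- A long row's car driving past the spot of a shorter row is the crossing that `no-crossing`
      -- forbids.
      unpassed : ∀ v → 0 < tally Mid? t₀ v → # (Passing? (suc v)) ≡ 0
      unpassed v 0<mid with r , ((c<a , ¬l) , refl) ← #-witness (λ r → Mid? r ×-dec (t₀ r ≟ v)) 0<mid =
        #-none (Passing? (suc v)) λ s (l , t₁≤v , v<t₀) →
          <⇒≱ v<t₀ (no-crossing (≤-<-trans ¬l l) c<a (≤-pred t₁≤v))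

      -- If no shorter row has its entry at `v`, the spots there all belong to long rows and get
      -- filled. Otherwise nobody drives on past `v`, and everybody present parks there.
      serve : ∀ v {d} → d ≡ # (Present? v) →
        C c v ⊓ d ≡ tally Long? t₀ v × d ∸ C c v ≡ # (Passing? (suc v))
      serve v refl rewrite spots v | departures v with tally Mid? t₀ v in mid
      ... | zero rewrite +-identityʳ (tally Long? t₀ v) =
              m≤n⇒m⊓n≡m (m≤m+n _ _) , m+n∸m≡n (tally Long? t₀ v) _
      ... | suc m rewrite unpassed v (subst (0 <_) (sym mid) (s≤s z≤n)) | +-identityʳ (tally Long? t₀ v) =
              m≥n⇒m⊓n≡n (m≤m+n _ _) , m≤n⇒m∸n≡0 (m≤m+n (tally Long? t₀ v) _)

      load≡ : ∀ v → load (C c) (tally Long? t₁) v ≡ # (Passing? v)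
      load≡ zero    = sym (#-none (Passing? 0) λ { r (_ , () , _) })
      load≡ (suc v) = proj₂ (serve v (trans (cong (_+ tally Long? t₁ v) (load≡ v)) (arrivals v)))

    -- The actual loads equal those of the imagined drive in which each car stops in its own row, so
    -- the occupied spots agree as well.
    park-tally : park (C c) (tally Long? t₁) ≗ tally Long? t₀
    park-tally v = proj₁ (serve v (trans (cong (_+ tally Long? t₁ v) (load≡ v)) (arrivals v)))

  key-tally : ∀ c k → key C 1 c k ≗ tally (λ r → k + c <? a r) (λ r → t r c)
  key-tally c zero zero    = trans (from-< {1} (C c) (s≤s z≤n)) (sym (contents-zero c))
  key-tally c zero (suc v) = from-≥ (C c) (s≤s z≤n)
  key-tally c (suc k) v = trans (park-cong (C c) key-tally′ v) (park-tally c k v)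
    where
    key-tally′ : key C 1 (suc c) k ≗ tally (λ r → suc k + c <? a r) (λ r → t r (suc c))
    key-tally′ = subst (λ x → key C 1 (suc c) k ≗ tally (λ r → x <? a r) (λ r → t r (suc c)))
      (+-suc k c) (key-tally (suc c) k)

  key-shape : ∀ d r → key C 1 0 d (row# r) ≡ 𝟙 (d <? a r)
  key-shape d r = trans (key-tally 0 d (row# r))
    (trans (cong (λ x → tally (λ r → x <? a r) (λ r → t r 0) (row# r)) (+-identityʳ d)) (first-column d r))

≤-via-< : ∀ {m n} → (∀ u → u < m → u < n) → m ≤ n
≤-via-< {m} {n} f = ≮⇒≥ λ n<m → n≮n n (f n n<m)

-- The atom filling with given contents

-- In an atom filling, the key of the entries ≥ v of column d is the set of rows
-- with an entry ≥ v in column d.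
atomGrid : ∀ {n} → (ℕ → Bag) → Grid n
atomGrid {n} C r d = below (λ u → 𝟙 (0 <? key C (suc u) 0 d (row# r))) n

module BuildAtom {n} {a : Fin n → ℕ} {C : ℕ → Bag} (isContents : IsContents a C) where
  open IsContents isContents

  atom : Grid n
  atom = atomGrid C

  private
    initial = λ u d (r : Fin n) → below-initial (λ u → 0 <? key C (suc u) 0 d (row# r))
      (λ u′ 0<key → ≤-trans 0<key (key-anti C (suc u′) 0 d (row# r))) n {u}

  atom⇒key : ∀ u d r → u < atom r d → 0 < key C (suc u) 0 d (row# r)
  atom⇒key u d r u<t = proj₂ (proj₁ (initial u d r) u<t)

  key⇒atom : ∀ u d r → 0 < key C (suc u) 0 d (row# r) → u < atom r d
  key⇒atom u d r 0<key = proj₂ (initial u d r)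
    (≮⇒≥ λ n<1+u → <⇒≢ 0<key (sym (key-zero C (suc u) 0 d (row# r) (≤-<-trans (toℕ<n r) n<1+u))))
    0<key

  first-contents : ∀ {r} → 0 < a r → C 0 (row# r) ≡ 1
  first-contents {r} 0<a = trans (sym (from-≥ {1} (C 0) (s≤s z≤n))) (trans (shape 0 r) (𝟙-yes (0 <? a r) 0<a))

  inside : ∀ {r d} → d < a r → 0 < atom r d
  inside {r} {d} d<a = key⇒atom 0 d r (≤-reflexive (sym (trans (shape d r) (𝟙-yes (d <? a r) d<a))))

  inside⁻¹ : ∀ {r d} → 0 < atom r d → d < a r
  inside⁻¹ {r} {d} 0<t = 𝟙-witness (d <? a r) (subst (0 <_) (shape d r) (atom⇒key 0 d r 0<t))

  first : ∀ {r} → 0 < a r → atom r 0 ≡ row# r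
  first {r} 0<a = ≤-antisym
    (≤-via-< λ u u<t → ≮⇒≥ λ r<1+u → <⇒≢ (atom⇒key u 0 r u<t) (sym (from-< (C 0) r<1+u)))
    (≤-via-< λ u u<r → key⇒atom u 0 r (≤-reflexive (sym (trans (from-≥ (C 0) u<r) (first-contents 0<a)))))

  module _ d {r u} (t≡1+u : atom r (suc d) ≡ suc u) where

    private
      D = key C (suc (suc u)) 0 (suc d)
      E = key C (suc u) 0 d
      D≡0 : D (row# r) ≡ 0
      D≡0 = n≤0⇒n≡0 (≮⇒≥ λ 0<D → <⇒≢ (key⇒atom (suc u) (suc d) r 0<D) (sym t≡1+u))
      D<key : D (row# r) < key C (suc u) 0 (suc d) (row# r)
      D<key = subst (_< key C (suc u) 0 (suc d) (row# r)) (sym D≡0)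
        (atom⇒key u (suc d) r (≤-reflexive (sym t≡1+u)))

    -- The entry `suc u` means that row `r` enters the key exactly when the threshold drops to
    -- `suc u`. With no entry `suc u` in the column, the key would not change at that moment.
    born-contents : C (suc d + 0) (suc u) ≡ 1
    born-contents = ≤-antisym (C≤1 (suc d + 0) (suc u))
      (n≢0⇒n>0 λ C≡0 → <⇒≢ D<key (sym (key-skip C 0 (suc d) C≡0 (row# r))))

    private
      D<grow : D (row# r) < grow D E (row# r)
      D<grow = subst (D (row# r) <_) (key-grow C 0 d born-contents (row# r)) D<key

    -- `grow` adds the least missing element, so no lower row was still missing when row `r`
    -- entered.
    born-first : ∀ (s : Fin n) → s Fin.< r → E (row# s) ≤ D (row# s)
    born-first s s<r = grew-first D E D<grow (row# s) (s≤s s<r)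

    born-< : D (row# r) < E (row# r)
    born-< = grew⇒< D E D<grow

  isGrid : IsGrid a atom
  isGrid = record
    { inside   = inside
    ; outside  = λ a≤c → n≤0⇒n≡0 (≮⇒≥ λ 0<t → <⇒≱ (inside⁻¹ 0<t) a≤c)
    ; dec      = λ r c → ≤-via-< λ u u<t → key⇒atom u c r
        (≤-trans (atom⇒key u (suc c) r u<t) (key-shrinks C (suc u) 0 c (row# r)))
    ; distinct = distinct
    ; first    = first
    }
    where
    distinct : ∀ {r s} c → r Fin.< s → 0 < atom r c → atom r c ≢ atom s c
    distinct zero r<s 0<t r≡s = <⇒≢ (s≤s r<s)
      (trans (sym (first (inside⁻¹ 0<t))) (trans r≡s (first (inside⁻¹ (subst (0 <_) r≡s 0<t)))))
    distinct {r} {s} (suc d) r<s 0<t r≡s with atom r (suc d) in tr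
    -- Row `r` is still missing at this threshold although it is lower than `s`, against `s` being
    -- the least missing row.
    ... | suc u = <⇒≱ (born-< d tr) (born-first d (sym r≡s) r r<s)

  isAtomGrid : IsAtomGrid a atom
  isAtomGrid = record { isGrid = isGrid ; triple = triple }
    where
    triple : ∀ {r s} c → r Fin.< s → 0 < atom s (suc c) →
      atom r c < atom s (suc c) ⊎ atom s (suc c) < atom r (suc c)
    triple {r} {s} c r<s 0<t with atom s (suc c) in ts
    ... | suc u with atom r c ≤? u
    ...   | yes t≤u = inj₁ (s≤s t≤u)
    -- Row `r` lies in the key of column `c` and is lower than `s`, so it entered the key of the
    -- next column at a higher threshold.
    ...   | no  t≰u = inj₂ (key⇒atom (suc u) (suc c) r
            (≤-trans (atom⇒key u c r (≰⇒> t≰u)) (born-first c ts r r<s)))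

  -- Every entry of the constructed grid occurs in `C`, and the column totals agree, so the
  -- inclusion is an equality.
  contents≗ : ∀ c → contents a atom c ≗ C c
  contents≗ c v with v ≤? n
  ... | no v≰n  = trans (contents-large c v (≰⇒> v≰n)) (sym (C-large c v (≰⇒> v≰n)))
    where open GridContents isGrid
  ... | yes v≤n = below-squeeze (suc n) (λ v _ → present v)
          (≤-reflexive (trans (total c) (sym (contents-total c)))) v (s≤s v≤n)
    where
    open GridContents isGrid hiding (C; isContents)
    occupied : ∀ c {r v} → c < a r → atom r c ≡ v → 0 < C c v
    occupied zero    0<a refl = ≤-reflexive (sym (trans (cong (C 0) (first 0<a)) (first-contents 0<a)))
    occupied (suc d) {r} d<a refl with atom r (suc d) in tr
    ... | zero  = contradiction (subst (0 <_) tr (inside d<a)) (n≮n 0)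
    ... | suc u = ≤-reflexive (sym (subst (λ x → C x (suc u) ≡ 1) (+-identityʳ (suc d)) (born-contents d tr)))
    present : ∀ v → contents a atom c v ≤ C c v
    present v with contents a atom c v in eq
    ... | zero  = z≤n
    ... | suc m with r , c<a , t≡v ← #-witness (λ r → (c <? a r) ×-dec (atom r c ≟ v))
                                       (subst (0 <_) (sym eq) (s≤s z≤n)) =
            ≤-trans (subst (_≤ 1) eq (contents≤1 c v)) (occupied c c<a t≡v)

module _ {n} {a : Fin n → ℕ} {t : Grid n} (isAtom : IsAtomGrid a t) where
  open AtomContents isAtom
  open GridContents (IsAtomGrid.isGrid isAtom)
  open BuildAtom (isContents key-shape)

  -- By `key-atom`, the entries of an atom grid are recovered from its keys by the very rule that
  -- defines `atomGrid`.
  atom-canonical : ∀ r c → atom r c ≡ t r c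
  atom-canonical r c = ≤-antisym
    (≤-via-< λ u u<t → 𝟙-witness (suc u ≤? t r c)
      (subst (0 <_) (key-atom c (suc u) r (s≤s z≤n)) (atom⇒key u c r u<t)))
    (≤-via-< λ u u<t → key⇒atom u c r (≤-reflexive (sym
      (trans (key-atom c (suc u) r (s≤s z≤n)) (𝟙-yes (suc u ≤? t r c) u<t)))))

-- The quasi-key tableau with given contents

depth : ∀ {c m} → c < m → ∃ λ k → m ≡ suc (k + c)
depth {c} {m} c<m = m ∸ suc c , trans (sym (m∸n+n≡m c<m)) (+-suc (m ∸ suc c) c)

row-length : ∀ m c → m ≤ c ⊎ ∃ λ k → m ≡ suc (k + c)
row-length m c with c <? m
... | no  c≮m = inj₁ (≮⇒≥ c≮m)
... | yes c<m = inj₂ (depth c<m)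

module _ {n} (a : Fin n → ℕ) where

  rankInLength : ℕ → Fin n → ℕ
  rankInLength ℓ = rank (λ r → a r ≟ ℓ)

  longer-split : ∀ {P : Pred (Fin n) 0ℓ} (P? : Decidable P) m →
    # (λ r → (m <? a r) ×-dec P? r) ≡
    # (λ r → (suc m <? a r) ×-dec P? r) + # (λ r → (a r ≟ suc m) ×-dec P? r)
  longer-split P? m = #-split (λ r → (m <? a r) ×-dec P? r)
    (λ r → (suc m <? a r) ×-dec P? r) (λ r → (a r ≟ suc m) ×-dec P? r)
    (λ (m<a , p) → [ (λ l → inj₁ (l , p)) , (λ e → inj₂ (sym e , p)) ]′ (m≤n⇒m<n∨m≡n m<a))
    (map₁ <⇒≤) (map₁ (≤-reflexive ∘ sym))
    (λ ((l , _) , (e , _)) → <⇒≢ l (sym e))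

  #-longer-split : ∀ m → # (λ r → m <? a r) ≡ # (λ r → suc m <? a r) + # (λ r → a r ≟ suc m)
  #-longer-split m = #-split (λ r → m <? a r) (λ r → suc m <? a r) (λ r → a r ≟ suc m)
    (λ m<a → [ inj₁ , inj₂ ∘ sym ]′ (m≤n⇒m<n∨m≡n m<a)) <⇒≤ (≤-reflexive ∘ sym)
    (λ (l , e) → <⇒≢ l (sym e))

-- The entries in column c of the rows of length k + c + 1.
lengthGroup : (ℕ → Bag) → (c k : ℕ) → Bag
lengthGroup C c k v = key C 1 c k v ∸ key C 1 c (suc k) v

-- Rows of equal length receive the entries of their group in increasing order.
tableauGrid : ∀ {n} → (Fin n → ℕ) → (ℕ → Bag) → Grid n
tableauGrid {n} a C r c with c <? a r
... | no  _ = 0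
... | yes _ = below
  (λ u → 𝟙 (below (lengthGroup C c (a r ∸ suc c)) (suc u) ≤? rankInLength a (a r) r)) (suc n)

module BuildKey {n} {a : Fin n → ℕ} {C : ℕ → Bag} (isContents : IsContents a C) where
  open IsContents isContents

  private
    group = lengthGroup C

  group+key : ∀ c k v → key C 1 c (suc k) v + group c k v ≡ key C 1 c k v
  group+key c k v = m+[n∸m]≡n (key-shrinks C 1 c k v)

  below-group+key : ∀ c k u →
    below (key C 1 c (suc k)) u + below (group c k) u ≡ below (key C 1 c k) u
  below-group+key c k u = trans (sym (below-+ (key C 1 c (suc k)) (group c k) u))
    (below-cong u λ v _ → group+key c k v)

  key-0 : ∀ c k → key C 1 c k 0 ≡ 0
  key-0 c k = key-zero C 1 c k 0 (s≤s z≤n)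

  -- The rows of the first column bound the number of cars from below and
  -- the contents of column k + c bound it from above.
  key-total : ∀ c k → below (key C 1 c k) (suc n) ≡ # (λ r → k + c <? a r)
  key-total c k = ≤-antisym (upper c k) (lower c k)
    where
    upper : ∀ c k → below (key C 1 c k) (suc n) ≤ # (λ r → k + c <? a r)
    upper c zero    = ≤-trans (below-mono (suc n) λ v _ → from≤ 1 (C c) v) (≤-reflexive (total c))
    upper c (suc k) = ≤-trans (below-key C 1 c k (suc n))
      (subst (λ x → below (key C 1 (suc c) k) (suc n) ≤ # (λ r → x <? a r)) (+-suc k c) (upper (suc c) k))
    lower : ∀ c k → # (λ r → k + c <? a r) ≤ below (key C 1 c k) (suc n)
    lower zero k = ≤-reflexive (begin
      # (λ r → k + 0 <? a r)                       ≡⟨ cong (λ x → # (λ r → x <? a r)) (+-identityʳ k) ⟩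
      # (λ r → k <? a r)                           ≡⟨ sum-cong-≗ (λ r → shape k r) ⟨
      sum {n} (key C 1 0 k ∘ row#)                 ≡⟨ sum≡below (key C 1 0 k ∘ suc) n ⟩
      below (key C 1 0 k ∘ suc) n                  ≡⟨ cong (_+ below (key C 1 0 k ∘ suc) n) (key-0 0 k) ⟨
      key C 1 0 k 0 + below (key C 1 0 k ∘ suc) n  ≡⟨ below-suc (key C 1 0 k) n ⟨
      below (key C 1 0 k) (suc n)                  ∎)
      where open ≡-Reasoning
    lower (suc c) k = ≤-trans
      (subst (λ x → # (λ r → x <? a r) ≤ below (key C 1 c (suc k)) (suc n)) (sym (+-suc k c)) (lower c (suc k)))
      (below-key C 1 c k (suc n))

  group-total : ∀ c k → below (group c k) (suc n) ≡ # (λ r → a r ≟ suc (k + c))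
  group-total c k = +-cancelˡ-≡ (below (key C 1 c (suc k)) (suc n)) _ _ (begin
    below (key C 1 c (suc k)) (suc n) + below (group c k) (suc n) ≡⟨ below-group+key c k (suc n) ⟩
    below (key C 1 c k) (suc n)                                   ≡⟨ key-total c k ⟩
    # (λ r → k + c <? a r)                                        ≡⟨ #-longer-split a (k + c) ⟩
    # (λ r → suc k + c <? a r) + # (λ r → a r ≟ suc (k + c))        ≡⟨ cong (_+ # (λ r → a r ≟ suc (k + c))) (key-total c (suc k)) ⟨
    below (key C 1 c (suc k)) (suc n) + # (λ r → a r ≟ suc (k + c)) ∎)
    where open ≡-Reasoning

  -- By conservation of cars the two prefix counts differ by the difference of two loads, and the
  -- larger key causes the larger load.
  group-shift : ∀ c k u → below (group c (suc k)) u ≤ below (group (suc c) k) u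
  group-shift c k u = +-cancelʳ-≤ lᴰ A B (≤-trans (+-monoʳ-≤ A lᴰ≤lᴱ) (≤-reflexive A+lᴱ≡B+lᴰ))
    where
    open ≡-Reasoning
    A  = below (group c (suc k)) u
    B  = below (group (suc c) k) u
    lᴱ = load (C c) (key C 1 (suc c) k) u
    lᴰ = load (C c) (key C 1 (suc c) (suc k)) u
    lᴰ≤lᴱ : lᴰ ≤ lᴱ
    lᴰ≤lᴱ = load-mono (C c) (key-shrinks C 1 (suc c) k) u
    p₁ = below (key C 1 c (suc k)) u
    p₂ = below (key C 1 c (suc (suc k))) u
    A+lᴱ≡B+lᴰ : A + lᴱ ≡ B + lᴰ
    A+lᴱ≡B+lᴰ = +-cancelˡ-≡ p₂ _ _ (begin
      p₂ + (A + lᴱ)  ≡⟨ +-assoc p₂ A lᴱ ⟨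
      p₂ + A + lᴱ    ≡⟨ cong (_+ lᴱ) (below-group+key c (suc k) u) ⟩
      p₁ + lᴱ        ≡⟨ below-park (C c) (key C 1 (suc c) k) u ⟩
      below (key C 1 (suc c) k) u ≡⟨ below-group+key (suc c) k u ⟨
      below (key C 1 (suc c) (suc k)) u + B ≡⟨ cong (_+ B) (below-park (C c) (key C 1 (suc c) (suc k)) u) ⟨
      p₂ + lᴰ + B    ≡⟨ +-assoc p₂ lᴰ B ⟩
      p₂ + (lᴰ + B)  ≡⟨ cong (p₂ +_) (+-comm lᴰ B) ⟩
      p₂ + (B + lᴰ)  ∎)

  tableau : Grid n
  tableau = tableauGrid a C

  outside : ∀ {r c} → a r ≤ c → tableau r c ≡ 0
  outside {r} {c} a≤c with c <? a r
  ... | no  _   = refl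
  ... | yes c<a = contradiction c<a (≤⇒≯ a≤c)

  inside⁻¹ : ∀ {r c} → 0 < tableau r c → c < a r
  inside⁻¹ 0<t = ≰⇒> λ a≤c → <⇒≢ 0<t (sym (outside a≤c))

  module _ (c k : ℕ) {r : Fin n} (a≡ : a r ≡ suc (k + c)) where

    private
      ρ = rankInLength a (suc (k + c)) r

      tableau≡ : tableau r c ≡ below (λ u → 𝟙 (below (group c k) (suc u) ≤? ρ)) (suc n)
      tableau≡ with c <? a r
      ... | no c≮a = contradiction (subst (c <_) (sym a≡) (s≤s (m≤n+m c k))) c≮a
      ... | yes _ rewrite a≡ | m+n∸n≡m k c = refl

      initial : ∀ u → _
      initial u = below-initial (λ u → below (group c k) (suc u) ≤? ρ)
        (λ u → ≤-trans (below-monoʳ (group c k) (n≤1+n (suc u)))) (suc n) {u}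

      -- Ranks start at 0, so a rank is smaller than the size of its group. This is what keeps the
      -- entry at most `n`.
      ρ< : ρ < below (group c k) (suc n)
      ρ< = subst (ρ <_) (sym (group-total c k))
        (#-strict (λ s → (a s ≟ suc (k + c)) ×-dec (toℕ s <? toℕ r)) (λ s → a s ≟ suc (k + c))
          proj₁ a≡ (n≮n (toℕ r) ∘ proj₂))

    tableau⇒group : ∀ u → u < tableau r c → below (group c k) (suc u) ≤ ρ
    tableau⇒group u u<t = proj₂ (proj₁ (initial u) (subst (u <_) tableau≡ u<t))

    tableau≤n : tableau r c ≤ n
    tableau≤n = ≮⇒≥ λ n<t → <⇒≱ ρ< (tableau⇒group n n<t)

    group⇒tableau : ∀ u → below (group c k) (suc u) ≤ ρ → u < tableau r c
    group⇒tableau u g≤ρ = subst (u <_) (sym tableau≡) (proj₂ (initial u)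
      (≰⇒> λ n<u → <⇒≱ ρ< (≤-trans (below-monoʳ (group c k) (m≤n⇒m≤1+n n<u)) g≤ρ)) g≤ρ)

  inside : ∀ {r c} → c < a r → 0 < tableau r c
  inside {r} {c} c<a with k , a≡ ← depth c<a = group⇒tableau c k a≡ 0
    (≤-trans (≤-reflexive (cong₂ _∸_ (key-0 c k) (key-0 c (suc k)))) z≤n)

  -- The rank of row `r` is the same in all columns, and by `group-shift` the group in column `c`
  -- exceeds it no earlier than the group in column `suc c`.
  decreasing : ∀ r c → tableau r (suc c) ≤ tableau r c
  decreasing r c with row-length (a r) (suc c)
  ... | inj₁ a≤c      = ≤-trans (≤-reflexive (outside a≤c)) z≤n
  ... | inj₂ (k , a≡) = ≤-via-< λ u u<t → group⇒tableau c (suc k) a≡′ u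
          (≤-trans (group-shift c k (suc u))
            (subst (λ ℓ → below (group (suc c) k) (suc u) ≤ rankInLength a ℓ r) (cong suc (+-suc k c))
              (tableau⇒group (suc c) k a≡ u u<t)))
    where
    a≡′ : a r ≡ suc (suc k + c)
    a≡′ = trans a≡ (cong suc (+-suc k c))

  increasing : ∀ {r s} c → r Fin.< s → a r ≡ a s → tableau r c ≤ tableau s c
  increasing {r} {s} c r<s ar≡as with row-length (a r) c
  ... | inj₁ a≤c      = ≤-trans (≤-reflexive (outside a≤c)) z≤n
  ... | inj₂ (k , a≡) = ≤-via-< λ u u<t → group⇒tableau c k (trans (sym ar≡as) a≡) u
          (≤-trans (tableau⇒group c k a≡ u u<t)
            (#-mono (λ q → (a q ≟ suc (k + c)) ×-dec (toℕ q <? toℕ r))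
                    (λ q → (a q ≟ suc (k + c)) ×-dec (toℕ q <? toℕ s)) (map₂ λ q<r → <-trans q<r r<s)))

  -- The entries less than `u` belong to the rows whose rank is less than the prefix count of the
  -- group, and there are exactly that many such ranks. Successive prefix counts then give the
  -- multiplicities.
  group-tally : ∀ c k v → v ≤ n → tally (λ r → a r ≟ suc (k + c)) (λ r → tableau r c) v ≡ group c k v
  group-tally c k v v≤n = +-cancelˡ-≡ (#< Len? col v) _ _ (begin
    #< Len? col v + tally Len? col v        ≡⟨ cong (_+ tally Len? col v) (below-tally Len? col v) ⟨
    below (tally Len? col) (suc v)          ≡⟨ below-tally Len? col (suc v) ⟩
    #< Len? col (suc v)                     ≡⟨ #<-col (suc v) (s≤s v≤n) ⟩
    below (group c k) v + group c k v       ≡⟨ cong (_+ group c k v) (#<-col v (m≤n⇒m≤1+n v≤n)) ⟨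
    #< Len? col v + group c k v             ∎)
    where
    open ≡-Reasoning
    Len? = λ r → a r ≟ suc (k + c)
    col = λ r → tableau r c
    #<-col : ∀ u → u ≤ suc n → #< Len? col u ≡ below (group c k) u
    #<-col zero    _     = #-none (λ r → Len? r ×-dec (col r <? 0)) λ r → λ ()
    #<-col (suc u) u<1+n = begin
      #< Len? col (suc u)
        ≡⟨ #-cong (λ r → Len? r ×-dec (col r <? suc u))
             (λ r → Len? r ×-dec (rank Len? r <? below (group c k) (suc u)))
             (λ {r} (l , t≤u) → l , ≰⇒> λ g≤ρ → <⇒≱ (group⇒tableau c k l u g≤ρ) (≤-pred t≤u))
             (λ {r} (l , ρ<g) → l , ≰⇒> λ u<t → <⇒≱ ρ<g (tableau⇒group c k l u u<t)) ⟩
      # (λ r → Len? r ×-dec (rank Len? r <? below (group c k) (suc u)))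
        ≡⟨ #-rank< Len? (below (group c k) (suc u)) ⟩
      below (group c k) (suc u) ⊓ # Len?
        ≡⟨ m≤n⇒m⊓n≡m (≤-trans (below-monoʳ (group c k) u<1+n) (≤-reflexive (group-total c k))) ⟩
      below (group c k) (suc u) ∎

  key-tally : ∀ c k v → v ≤ n → tally (λ r → k + c <? a r) (λ r → tableau r c) v ≡ key C 1 c k v
  key-tally c k v v≤n = go (sum a) k (≤-trans (m≤m+n (sum a) k) (+-monoʳ-≤ (sum a) (m≤m+n k c)))
    where
    open ≡-Reasoning
    col = λ r → tableau r c
    go : ∀ j k → sum a ≤ j + (k + c) → tally (λ r → k + c <? a r) col v ≡ key C 1 c k v
    -- The recursion adds the length groups from the longest rows down. No row is longer than
    -- `sum a`, and by `key-total` no element of the key is left there either.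
    go zero k Σ≤k+c = trans
      (#-none (λ r → (k + c <? a r) ×-dec (col r ≟ v)) (λ r → ¬long r ∘ proj₁))
      (sym (n≤0⇒n≡0 (≤-trans (below-term (key C 1 c k) (s≤s v≤n))
        (≤-reflexive (trans (key-total c k) (#-none (λ r → k + c <? a r) ¬long))))))
      where
      ¬long : ∀ r → ¬ (k + c < a r)
      ¬long r l = <⇒≱ l (≤-trans (sum-term-≤ a r) Σ≤k+c)
    go (suc j) k Σ≤ = begin
      tally (λ r → k + c <? a r) col v
        ≡⟨ longer-split a (λ r → col r ≟ v) (k + c) ⟩
      tally (λ r → suc k + c <? a r) col v + tally (λ r → a r ≟ suc (k + c)) col v
        ≡⟨ cong₂ _+_ (go j (suc k) (≤-trans Σ≤ (≤-reflexive (sym (+-suc j (k + c)))))) (group-tally c k v v≤n) ⟩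
      key C 1 c (suc k) v + group c k v
        ≡⟨ group+key c k v ⟩
      key C 1 c k v ∎

  tableau-bounded : ∀ r c → tableau r c ≤ n
  tableau-bounded r c with row-length (a r) c
  ... | inj₁ a≤c      = ≤-trans (≤-reflexive (outside a≤c)) z≤n
  ... | inj₂ (k , a≡) = tableau≤n c k a≡

  injective : ∀ {r s} c → 0 < tableau r c → tableau r c ≡ tableau s c → r ≡ s
  injective {r} {s} c 0<t r≡s = #-≤1-unique (λ q → (c <? a q) ×-dec (tableau q c ≟ tableau r c))
    (≤-trans (≤-reflexive (key-tally c 0 (tableau r c) (tableau-bounded r c)))
      (≤-trans (key≤ C 1 c 0 (tableau r c)) (C≤1 c (tableau r c))))
    (inside⁻¹ 0<t , refl) (inside⁻¹ (subst (0 <_) r≡s 0<t) , sym r≡s)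

  -- By `shape`, each length group in column 0 consists of the numbers of the rows of that length.
  -- Distributed in increasing order, they return to their own rows.
  first : ∀ {r} → 0 < a r → tableau r 0 ≡ row# r
  first {r} 0<a with k , a≡ ← depth 0<a = ≤-antisym
    (≮⇒≥ λ r<t → n≮n (row# r) (#<≤rank⇒< Len? row# row#-mono a≡
      (subst (_≤ rank Len? r) (below-group (suc (row# r)) (s≤s (toℕ<n r)))
        (tableau⇒group 0 k a≡ (row# r) r<t))))
    (≤-via-< λ u u<r → group⇒tableau 0 k a≡ u
      (subst (_≤ rank Len? r) (sym (below-group (suc u) (≤-trans u<r (m≤n⇒m≤1+n (toℕ<n r)))))
        (<⇒#<≤rank Len? row# row#-mono a≡ u<r)))
    where
    Len? = λ s → a s ≟ suc (k + 0)
    row#-mono : ∀ {r s : Fin n} → r Fin.< s → a r ≡ suc (k + 0) → a s ≡ suc (k + 0) → row# r ≤ row# s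
    row#-mono r<s _ _ = s≤s (<⇒≤ r<s)
    group≡ : ∀ v → v ≤ n → group 0 k v ≡ tally Len? row# v
    group≡ = row-induction (λ v → group 0 k v ≡ tally Len? row# v)
      (trans (cong₂ _∸_ (key-0 0 k) (key-0 0 (suc k)))
        (sym (#-none (λ r → Len? r ×-dec (row# r ≟ 0)) λ r → λ ())))
      λ r → trans (cong₂ _∸_
          (trans (shape k r) (𝟙-split (k <? a r) (suc k <? a r) (Len? r)
            (λ k<a → [ inj₁ , (λ e → inj₂ (trans (sym e) (cong suc (sym (+-identityʳ k))))) ]′
              (m≤n⇒m<n∨m≡n k<a))
            <⇒≤ (λ e → ≤-reflexive (trans (cong suc (sym (+-identityʳ k))) (sym e)))
            (λ (l , e) → <⇒≢ l (trans (cong suc (sym (+-identityʳ k))) (sym e)))))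
          (shape (suc k) r))
        (trans (m+n∸m≡n (𝟙 (suc k <? a r)) (𝟙 (Len? r))) (single r))
      where
      single : ∀ r → 𝟙 (Len? r) ≡ tally Len? row# (row# r)
      single r with Len? r
      ... | yes l = ≤-antisym (#-some Q? (l , refl)) (#-≤1 Q? λ where
              r<s (_ , e) (_ , e′) → <⇒≢ r<s (suc-injective (trans e (sym e′))))
        where Q? = λ s → Len? s ×-dec (row# s ≟ row# r)
      ... | no ¬l = sym (#-none (λ s → Len? s ×-dec (row# s ≟ row# r)) λ s (l , e) →
              ¬l (subst (λ x → a x ≡ suc (k + 0)) (toℕ-injective (suc-injective e)) l))
    below-group : ∀ u → u ≤ suc n → below (group 0 k) u ≡ #< Len? row# u
    below-group u u≤1+n = trans
      (below-cong u λ v v<u → group≡ v (≤-pred (≤-trans v<u u≤1+n))) (below-tally Len? row# u)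

  isGrid : IsGrid a tableau
  isGrid = record
    { inside   = inside
    ; outside  = outside
    ; dec      = decreasing
    ; distinct = λ c r<s 0<t r≡s → <⇒≢ r<s (cong toℕ (injective c 0<t r≡s))
    ; first    = first
    }

  -- The spot `v` of the shorter row `r` stays free when the long rows park, so no car drives past
  -- it. Hence equally many long rows have an entry at most `v` in columns `c` and `suc c`; one set
  -- of rows contains the other, so they coincide, and row `s` is in both.
  no-crossing : ∀ {r s c} → a r < a s → c < a r → tableau s (suc c) ≤ tableau r c →
    tableau s c ≤ tableau r c
  no-crossing {r} {s} {c} ar<as c<ar ts≤tr
    with k , as≡ ← depth (≤-<-trans c<ar ar<as) =
    ≤-pred (proj₂ (#-exhausts (λ q → Long? q ×-dec (t₀ q <? suc v)) (λ q → Long? q ×-dec (t₁ q <? suc v))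
      (map₂ λ t₀≤v → ≤-<-trans (decreasing _ c) t₀≤v) #≤#
      (≤-reflexive (trans (cong suc (sym (+-suc k c))) (sym as≡)) , s≤s ts≤tr)))
    where
    v  = tableau r c
    t₀ = λ q → tableau q c
    t₁ = λ q → tableau q (suc c)
    Long? = λ q → suc k + c <? a q
    -- Row r ends before the long rows do, so their cars leave its spot v free.
    free : key C 1 c (suc k) v ≡ 0
    free = trans (sym (key-tally c (suc k) v (tableau-bounded r c)))
      (#-none (λ q → Long? q ×-dec (t₀ q ≟ v)) λ q (l , tq≡v) →
        <⇒≱ l (subst (λ x → a x ≤ suc k + c) (injective c (inside c<ar) (sym tq≡v))
          (≤-pred (subst (a r <_) (trans as≡ (cong suc (+-suc k c))) ar<as))))
    occupied : 0 < C c v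
    occupied = ≤-trans
      (subst (0 <_) (key-tally c 0 v (tableau-bounded r c))
        (#-some (λ q → (c <? a q) ×-dec (t₀ q ≟ v)) (c<ar , refl)))
      (key≤ C 1 c 0 v)
    D = key C 1 (suc c) k
    -- If more cars than spots were present at `v`, the spot would be taken.
    no-load : load (C c) D (suc v) ≡ 0
    no-load = m≤n⇒m∸n≡0 (≮⇒≥ λ C<x →
      <⇒≢ occupied (sym (trans (sym (m≤n⇒m⊓n≡m (<⇒≤ C<x))) free)))
    tally≡ : below (tally Long? t₁) (suc v) ≡ below D (suc v)
    tally≡ = below-cong (suc v) λ w w≤v → trans
      (cong (λ x → tally (λ q → x <? a q) t₁ w) (sym (+-suc k c)))
      (key-tally (suc c) k w (≤-trans (≤-pred w≤v) (tableau-bounded r c)))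
    #≤# : #< Long? t₁ (suc v) ≤ #< Long? t₀ (suc v)
    #≤# = ≤-reflexive (begin
      #< Long? t₁ (suc v)                                 ≡⟨ below-tally Long? t₁ (suc v) ⟨
      below (tally Long? t₁) (suc v)                      ≡⟨ tally≡ ⟩
      below D (suc v)                                     ≡⟨ below-park (C c) D (suc v) ⟨
      below (key C 1 c (suc k)) (suc v) + load (C c) D (suc v)
        ≡⟨ trans (cong (below (key C 1 c (suc k)) (suc v) +_) no-load) (+-identityʳ _) ⟩
      below (key C 1 c (suc k)) (suc v)
        ≡⟨ below-cong (suc v) (λ w w≤v → key-tally c (suc k) w (≤-trans (≤-pred w≤v) (tableau-bounded r c))) ⟨
      below (tally Long? t₀) (suc v)                      ≡⟨ below-tally Long? t₀ (suc v) ⟩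
      #< Long? t₀ (suc v)                                 ∎)
      where open ≡-Reasoning

  isKeyGrid : IsKeyGrid a tableau
  isKeyGrid = record { isGrid = isGrid ; witnessed = witnessed ; dominates = dominates }
    where
    -- Mutual induction on the column: strictness within a column comes from the row numbers or from
    -- the previous step, and `no-crossing` turns it into dominance.
    dominates-column : ∀ {r s} c → r Fin.< s → a r < a s → c < a r → tableau r c < tableau s c
    dominates : ∀ {r s} c → r Fin.< s → a r < a s → c < a r → tableau r c < tableau s (suc c)
    dominates-column zero r<s ar<as 0<ar =
      subst₂ _<_ (sym (first 0<ar)) (sym (first (<-trans 0<ar ar<as))) (s≤s r<s)
    dominates-column {r} (suc c) r<s ar<as c<ar =
      ≤-<-trans (decreasing r c) (dominates c r<s ar<as (<-trans (n<1+n c) c<ar))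
    dominates c r<s ar<as c<ar = ≰⇒> λ ts≤tr →
      <⇒≱ (dominates-column c r<s ar<as c<ar) (no-crossing ar<as c<ar ts≤tr)
    witnessed : ∀ {r s} c → r Fin.< s → 0 < tableau s c → tableau s c < tableau r c →
      tableau s c < tableau r (suc c)
    witnessed {r} {s} c r<s 0<ts ts<tr with <-cmp (a r) (a s)
    ... | tri≈ _ ar≡as _ = contradiction (increasing c r<s ar≡as) (<⇒≱ ts<tr)
    ... | tri< ar<as _ _ = contradiction ts<tr
            (<-asym (dominates-column c r<s ar<as (inside⁻¹ (≤-<-trans z≤n ts<tr))))
    ... | tri> _ _ as<ar = ≰⇒> λ tr≤ts → <⇒≱ ts<tr (no-crossing as<ar (inside⁻¹ 0<ts) tr≤ts)

  contents≗ : ∀ c → contents a tableau c ≗ C c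
  contents≗ c v with v ≤? n
  ... | no v≰n  = trans (contents-large c v (≰⇒> v≰n)) (sym (C-large c v (≰⇒> v≰n)))
    where open GridContents isGrid
  ... | yes v≤n = trans (key-tally c 0 v v≤n) (from-1 v)
    where
    from-1 : ∀ v → from 1 (C c) v ≡ C c v
    from-1 zero    = sym (C-zero c)
    from-1 (suc v) = refl

module _ {n} {a : Fin n → ℕ} {t : Grid n} (isKey : IsKeyGrid a t) where
  open IsKeyGrid isKey using (outside; increasing)
  open KeyContents isKey
  open GridContents (IsKeyGrid.isGrid isKey)
  open BuildKey (isContents key-shape) hiding (outside; increasing; key-tally)
  private module Build = BuildKey (isContents key-shape)

  group-key : ∀ c k → lengthGroup C c k ≗ tally (λ r → a r ≟ suc (k + c)) (λ r → t r c)
  group-key c k v = begin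
    key C 1 c k v ∸ key C 1 c (suc k) v
      ≡⟨ cong₂ _∸_ (trans (key-tally c k v) (longer-split a (λ r → t r c ≟ v) (k + c))) (key-tally c (suc k) v) ⟩
    (long + tally (λ r → a r ≟ suc (k + c)) (λ r → t r c) v) ∸ long
      ≡⟨ m+n∸m≡n long _ ⟩
    tally (λ r → a r ≟ suc (k + c)) (λ r → t r c) v ∎
    where
    open ≡-Reasoning
    long = tally (λ r → suc k + c <? a r) (λ r → t r c) v

  -- In a quasi-key grid, rows of equal length increase upward in each column, so within a length
  -- group the rank determines the entry, as in the definition of `tableauGrid`.
  tableau-canonical : ∀ r c → tableau r c ≡ t r c
  tableau-canonical r c with row-length (a r) c
  ... | inj₁ a≤c = trans (Build.outside a≤c) (sym (outside a≤c))
  ... | inj₂ (k , a≡) = ≤-antisym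
      (≤-via-< λ u u<t → #<≤rank⇒< Len? col incr a≡
        (subst (_≤ rank Len? r) (below≡ (suc u)) (tableau⇒group c k a≡ u u<t)))
      (≤-via-< λ u u<t → group⇒tableau c k a≡ u
        (subst (_≤ rank Len? r) (sym (below≡ (suc u))) (<⇒#<≤rank Len? col incr a≡ u<t)))
    where
    Len? = λ s → a s ≟ suc (k + c)
    col = λ s → t s c
    incr : ∀ {r s} → r Fin.< s → a r ≡ suc (k + c) → a s ≡ suc (k + c) → t r c ≤ t s c
    incr r<s ar≡ as≡ = increasing c r<s (trans ar≡ (sym as≡))
    below≡ : ∀ u → below (lengthGroup C c k) u ≡ #< Len? col u
    below≡ u = trans (below-cong u λ v _ → group-key c k v) (below-tally Len? col u)

-- Fillings as grids

entry : ∀ {k} → Vec ℕ k → ℕ → ℕ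
entry []      c       = 0
entry (x ∷ v) zero    = x
entry (x ∷ v) (suc c) = entry v c

entry-lookup : ∀ {k} (v : Vec ℕ k) c → entry v (toℕ c) ≡ lookup v c
entry-lookup (x ∷ v) Fin.zero    = refl
entry-lookup (x ∷ v) (Fin.suc c) = entry-lookup v c

entry-outside : ∀ {k} (v : Vec ℕ k) {c} → k ≤ c → entry v c ≡ 0
entry-outside []      _         = refl
entry-outside (x ∷ v) (s≤s k≤c) = entry-outside v k≤c

entry-tabulate : ∀ k f {c} → c < k → entry (tabulate {n = k} (f ∘ toℕ)) c ≡ f c
entry-tabulate (suc k) f {zero}  _         = refl
entry-tabulate (suc k) f {suc c} (s≤s c<k) = entry-tabulate k (f ∘ suc) c<k

entry-injective : ∀ {k} (v w : Vec ℕ k) → entry v ≗ entry w → v ≡ w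
entry-injective []      []      eq = refl
entry-injective (x ∷ v) (y ∷ w) eq = cong₂ _∷_ (eq 0) (entry-injective v w (eq ∘ suc))

grid : ∀ {n} {a : WeakComposition n} → Filling a → Grid n
grid T r = entry (lookup⁺ T r)

fill : ∀ {n} (a : WeakComposition n) → Grid n → Filling a
fill []      t = []
fill (k ∷ a) t = tabulate (t Fin.zero ∘ toℕ) ∷ fill a (t ∘ Fin.suc)

grid-injective : ∀ {n} {a : WeakComposition n} (T U : Filling a) →
  (∀ r → grid T r ≗ grid U r) → T ≡ U
grid-injective []      []      eq = refl
grid-injective (v ∷ T) (w ∷ U) eq =
  cong₂ _∷_ (entry-injective v w (eq Fin.zero)) (grid-injective T U (eq ∘ Fin.suc))

grid-fill : ∀ {n} (a : WeakComposition n) t r {c} → c < lookup a r → grid (fill a t) r c ≡ t r c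
grid-fill (k ∷ a) t Fin.zero    c<k = entry-tabulate k (t Fin.zero) c<k
grid-fill (k ∷ a) t (Fin.suc r) c<a = grid-fill a (t ∘ Fin.suc) r c<a

module _ {n} {a : WeakComposition n} (T : Filling a) where

  grid-cell : ∀ r c → grid T r (toℕ c) ≡ T ⟨ r , c ⟩
  grid-cell r c = entry-lookup (lookup⁺ T r) c

  cell-at : ∀ r {γ : Column a r} {c} → toℕ γ ≡ c → T ⟨ r , γ ⟩ ≡ grid T r c
  cell-at r {γ} refl = sym (grid-cell r γ)

  grid-outside : ∀ {r c} → lookup a r ≤ c → grid T r c ≡ 0
  grid-outside {r} = entry-outside (lookup⁺ T r)

  grid-inside : ∀ {r c} → 0 < grid T r c → c < lookup a r
  grid-inside 0<t = ≰⇒> λ a≤c → <⇒≢ 0<t (sym (grid-outside a≤c))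

column : ∀ {m c} → c < m → ∃ λ (γ : Fin m) → toℕ γ ≡ c
column c<m = fromℕ< c<m , toℕ-fromℕ< c<m

module _ {n} {a : WeakComposition n} (T : Filling a)
  (positive : Positive T) (rowsWeaklyDecrease : RowsWeaklyDecrease T)
  (columnsDistinct : ColumnsDistinct T) (firstColumn : FirstColumnIsRowIndex T) where

  filling-isGrid : IsGrid (lookup a) (grid T)
  filling-isGrid = record
    { inside   = inside
    ; outside  = grid-outside T
    ; dec      = dec
    ; distinct = distinct
    ; first    = first
    }
    where
    inside : ∀ {r c} → c < lookup a r → 0 < grid T r c
    inside {r} c<a with γ , refl ← column c<a = subst (0 <_) (sym (grid-cell T r γ)) (positive r γ)
    dec : ∀ r c → grid T r (suc c) ≤ grid T r c
    dec r c with suc c <? lookup a r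
    ... | no  c≮a = ≤-trans (≤-reflexive (grid-outside T (≮⇒≥ c≮a))) z≤n
    ... | yes c<a with γ , refl ← column (<-trans (n<1+n c) c<a) | γ′ , γ′≡ ← column c<a =
            subst₂ _≤_ (cell-at T r γ′≡) (sym (grid-cell T r γ))
              (rowsWeaklyDecrease r γ γ′ (≤-reflexive (sym γ′≡)))
    distinct : ∀ {r s} c → r Fin.< s → 0 < grid T r c → grid T r c ≢ grid T s c
    distinct {r} {s} c r<s 0<t r≡s
      with γ , refl ← column (grid-inside T 0<t)
         | δ , δ≡ ← column (grid-inside T (subst (0 <_) r≡s 0<t)) =
      columnsDistinct r s r<s γ δ (sym δ≡) (trans (sym (grid-cell T r γ))
        (trans r≡s (trans (cong (grid T s) (sym δ≡)) (grid-cell T s δ))))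
    first : ∀ {r} → 0 < lookup a r → grid T r 0 ≡ row# r
    first {r} 0<a with γ , γ≡ ← column 0<a =
      trans (cong (grid T r) (sym γ≡)) (trans (grid-cell T r γ) (firstColumn r γ γ≡))

module _ {n} {a : WeakComposition n} {T : Filling a} {t : Grid n}
  (cell : ∀ r (c : Column a r) → T ⟨ r , c ⟩ ≡ t r (toℕ c)) where

  module _ (isGrid : IsGrid (lookup a) t) where
    open IsGrid isGrid

    grid-positive : Positive T
    grid-positive r c = subst (0 <_) (sym (cell r c)) (inside (toℕ<n c))

    grid-decreasing : RowsWeaklyDecrease T
    grid-decreasing r c c′ c<c′ = subst₂ _≤_ (sym (cell r c′)) (sym (cell r c)) (antitone r (<⇒≤ c<c′))

    grid-distinct : ColumnsDistinct T
    grid-distinct r s r<s c d c≡d Tr≡Ts = distinct (toℕ c) r<s (inside (toℕ<n c))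
      (trans (sym (cell r c)) (trans Tr≡Ts (trans (cell s d) (cong (t s) (sym c≡d)))))

    grid-firstColumn : FirstColumnIsRowIndex T
    grid-firstColumn r c c≡0 = trans (cell r c) (trans (cong (t r) c≡0) (first (≤-<-trans z≤n (toℕ<n c))))

    grid-rowBounded : RowBounded T
    grid-rowBounded r c = subst (_≤ row# r) (sym (cell r c)) (≤row# r (toℕ c))

    grid-firstIncreases : FirstColumnIncreases T
    grid-firstIncreases r s r<s c d c≡0 d≡0 =
      subst₂ _<_ (sym (grid-firstColumn r c c≡0)) (sym (grid-firstColumn s d d≡0)) (s≤s r<s)

  grid⇒atom : IsAtomGrid (lookup a) t → IsAtomFilling T
  grid⇒atom isAtom = mkAtom (grid-positive isGrid) (grid-decreasing isGrid) (grid-distinct isGrid)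
    typeA typeB (grid-firstColumn isGrid)
    where
    open IsAtomGrid isAtom
    typeA : TypeATriplesInverted T
    typeA r s r<s _ γ α β α≡ β≡
      rewrite cell r γ | cell r α | cell s β | α≡ | β≡
      with triple (toℕ γ) r<s (inside (subst (_< lookup a s) β≡ (toℕ<n β)))
    ... | inj₁ γ<β = inj₁ (γ<β , dec r (toℕ γ))
    ... | inj₂ β<α = inj₂ (dec r (toℕ γ) , β<α)
    typeB : TypeBTriplesInverted T
    typeB r s r<s ar<as γ α β α≡ β≡
      rewrite cell s γ | cell s α | cell r β | α≡ | β≡ =
      inj₂ (dec s (toℕ γ) , dominates (toℕ γ) r<s ar<as (subst (_< lookup a r) β≡ (toℕ<n β)))

  grid⇒quasiKey : IsKeyGrid (lookup a) t → IsQuasiKeyTableau¹ T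
  grid⇒quasiKey isKey =
    mkQuasiKey (grid-positive isGrid) (grid-decreasing isGrid) (grid-rowBounded isGrid)
      (grid-distinct isGrid) (grid-firstIncreases isGrid) witnesses dominate ,
    grid-firstColumn isGrid
    where
    open IsKeyGrid isKey
    witnesses : ColumnInversionsWitnessed T
    witnesses r s r<s c d c≡d rewrite cell s d | cell r c | sym c≡d = λ ts<tr →
      let ts<tr′ = witnessed (toℕ c) r<s
            (inside (subst (_< lookup a s) (sym c≡d) (toℕ<n d))) ts<tr
          c′ , c′≡ = column (inside⁻¹ (≤-<-trans z≤n ts<tr′))
      in c′ , c′≡ , subst (t s (toℕ c) <_) (trans (cong (t r) (sym c′≡)) (sym (cell r c′))) ts<tr′
    dominate : LongerHigherRowsDominate T
    dominate r s r<s ar<as c d d≡ rewrite cell r c | cell s d | d≡ =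
      dominates (toℕ c) r<s ar<as (toℕ<n c)

module _ {n} {a : WeakComposition n} {T : Filling a} where

  atom⇒grid : IsAtomFilling T → IsAtomGrid (lookup a) (grid T)
  atom⇒grid (mkAtom pos decr dist typeA typeB first#) = record { isGrid = isGrid ; triple = triple }
    where
    isGrid = filling-isGrid T pos decr dist first#
    open IsGrid isGrid
    -- Mutual induction on the column: the comparison within a column excludes the alternative
    -- `β > γ` of a type B triple, and the other alternative is dominance.
    dominates-column : ∀ {r s} c → r Fin.< s → lookup a r < lookup a s → c < lookup a r →
      grid T r c < grid T s c
    dominates : ∀ {r s} c → r Fin.< s → lookup a r < lookup a s → c < lookup a r →
      grid T r c < grid T s (suc c)
    dominates-column zero r<s ar<as 0<ar =
      subst₂ _<_ (sym (first 0<ar)) (sym (first (<-trans 0<ar ar<as))) (s≤s r<s)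
    dominates-column {r} (suc c) r<s ar<as c<ar =
      ≤-<-trans (dec r c) (dominates c r<s ar<as (<-trans (n<1+n c) c<ar))
    dominates {r} {s} c r<s ar<as c<ar
      with β , β≡ ← column c<ar | γ , γ≡ ← column (<-trans c<ar ar<as)
         | α , α≡ ← column (≤-<-trans c<ar ar<as)
      with typeB r s r<s ar<as γ α β (trans α≡ (cong suc (sym γ≡))) (trans β≡ (sym γ≡))
    ... | inj₁ (γ<β , _) = contradiction (dominates-column c r<s ar<as c<ar)
            (<⇒≯ (subst₂ _<_ (cell-at T s γ≡)
                             (cell-at T r β≡) γ<β))
    ... | inj₂ (_ , β<α) = subst₂ _<_ (cell-at T r β≡)
                             (cell-at T s α≡) β<α
    triple : ∀ {r s} c → r Fin.< s → 0 < grid T s (suc c) →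
      grid T r c < grid T s (suc c) ⊎ grid T s (suc c) < grid T r (suc c)
    -- Past the end of row `r` the entry is 0; otherwise dominance applies if row `s` is longer, and
    -- a type A triple if it is not.
    triple {r} {s} c r<s 0<ts with c <? lookup a r | lookup a r <? lookup a s
    ... | no  c≮a | _         = inj₁ (subst (_< grid T s (suc c)) (sym (grid-outside T (≮⇒≥ c≮a))) 0<ts)
    ... | yes c<a | yes ar<as = inj₁ (dominates c r<s ar<as c<a)
    ... | yes c<a | no  ar≮as
      with c+1<as ← grid-inside T 0<ts
      with γ , γ≡ ← column c<a | α , α≡ ← column (<-≤-trans c+1<as (≮⇒≥ ar≮as)) | β , β≡ ← column c+1<as
      with typeA r s r<s (≮⇒≥ ar≮as) γ α β (trans α≡ (cong suc (sym γ≡))) (trans β≡ (cong suc (sym γ≡)))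
    ...   | inj₁ (γ<β , _) = inj₁ (subst₂ _<_ (cell-at T r γ≡)
                               (cell-at T s β≡) γ<β)
    ...   | inj₂ (_ , β<α) = inj₂ (subst₂ _<_ (cell-at T s β≡)
                               (cell-at T r α≡) β<α)

  quasiKey⇒grid : IsQuasiKeyTableau¹ T → IsKeyGrid (lookup a) (grid T)
  quasiKey⇒grid (mkQuasiKey pos decr _ dist _ witnesses dominate , first#) =
    record { isGrid = isGrid ; witnessed = witnessed ; dominates = dominates }
    where
    isGrid = filling-isGrid T pos decr dist first#
    witnessed : ∀ {r s} c → r Fin.< s → 0 < grid T s c → grid T s c < grid T r c →
      grid T s c < grid T r (suc c)
    witnessed {r} {s} c r<s 0<ts ts<tr
      with γ , γ≡ ← column (grid-inside T (≤-<-trans z≤n ts<tr)) | δ , refl ← column (grid-inside T 0<ts)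
      with γ′ , γ′≡ , lt ← witnesses r s r<s γ δ γ≡
             (subst₂ _<_ (grid-cell T s δ) (trans (cong (grid T r) (sym γ≡)) (grid-cell T r γ)) ts<tr) =
      subst₂ _<_ (sym (grid-cell T s δ))
        (trans (sym (grid-cell T r γ′)) (cong (grid T r) (trans γ′≡ (cong suc γ≡)))) lt
    dominates : ∀ {r s} c → r Fin.< s → lookup a r < lookup a s → c < lookup a r →
      grid T r c < grid T s (suc c)
    dominates {r} {s} c r<s ar<as c<ar
      with γ , refl ← column c<ar | δ , δ≡ ← column (≤-<-trans c<ar ar<as) =
      subst₂ _<_ (sym (grid-cell T r γ)) (cell-at T s δ≡)
        (dominate r s r<s ar<as γ δ δ≡)

-- Weights

-- The range `M` may exceed the row, so that one bound serves all rows and the sums over rows and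
-- columns can be interchanged.
length-filter-row : ∀ v {k} (row : Vec ℕ k) M → k ≤ M →
  length (filter (_≟ v) (toList row)) ≡ below (λ c → 𝟙 ((c <? k) ×-dec (entry row c ≟ v))) M
length-filter-row v [] M k≤M = sym (below-zero M)
  where
  below-zero : ∀ M → below (λ c → 𝟙 ((c <? 0) ×-dec (0 ≟ v))) M ≡ 0
  below-zero zero    = refl
  below-zero (suc M) = cong₂ _+_ (below-zero M) (𝟙-no ((M <? 0) ×-dec (0 ≟ v)) λ ())
length-filter-row v {suc k} (x ∷ row) (suc M) (s≤s k≤M) = begin
  length (filter (_≟ v) (x ∷ toList row))
    ≡⟨ head-entry ⟩
  𝟙 (x ≟ v) + length (filter (_≟ v) (toList row))
    ≡⟨ cong₂ _+_ (𝟙-cong (x ≟ v) ((0 <? suc k) ×-dec (x ≟ v)) (s≤s z≤n ,_) proj₂)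
         (trans (length-filter-row v row M k≤M) (below-cong M λ c _ →
           𝟙-cong ((c <? k) ×-dec (entry row c ≟ v)) ((suc c <? suc k) ×-dec (entry row c ≟ v))
             (map₁ s≤s) (map₁ ≤-pred))) ⟩
  B 0 + below (B ∘ suc) M
    ≡⟨ below-suc B M ⟨
  below B (suc M) ∎
  where
  open ≡-Reasoning
  B : Bag
  B c = 𝟙 ((c <? suc k) ×-dec (entry (x ∷ row) c ≟ v))
  head-entry : length (filter (_≟ v) (x ∷ toList row)) ≡ 𝟙 (x ≟ v) + length (filter (_≟ v) (toList row))
  head-entry with x ≟ v
  ... | yes x≡v = cong length (filter-accept (_≟ v) x≡v)
  ... | no  x≢v = cong length (filter-reject (_≟ v) x≢v)

below-sum : ∀ {n} (f : ℕ → Fin n → ℕ) M →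
  below (λ c → sum (f c)) M ≡ sum (λ r → below (λ c → f c r) M)
below-sum {n} f zero  = sym (sum-zero {n} λ _ → refl)
below-sum f (suc M) = trans (cong (_+ sum (f M)) (below-sum f M))
  (sym (∑-distrib-+ (λ r → below (λ c → f c r) M) (f M)))

module _ {n} {a : WeakComposition n} where

  columns : Filling a → ℕ → Bag
  columns T = contents (lookup a) (grid T)

length-filter-entries : ∀ {n} {a : WeakComposition n} (T : Filling a) v M → (∀ r → lookup a r ≤ M) →
  length (filter (_≟ v) (entries T)) ≡
  sum (λ r → below (λ c → 𝟙 ((c <? lookup a r) ×-dec (grid T r c ≟ v))) M)
length-filter-entries []        v M a≤M = refl
length-filter-entries (row ∷ T) v M a≤M = begin
  length (filter (_≟ v) (toList row ++ entries T))
    ≡⟨ cong length (filter-++ (_≟ v) (toList row) (entries T)) ⟩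
  length (filter (_≟ v) (toList row) ++ filter (_≟ v) (entries T))
    ≡⟨ length-++ (filter (_≟ v) (toList row)) ⟩
  length (filter (_≟ v) (toList row)) + length (filter (_≟ v) (entries T))
    ≡⟨ cong₂ _+_ (length-filter-row v row M (a≤M Fin.zero)) (length-filter-entries T v M (a≤M ∘ Fin.suc)) ⟩
  _ ∎
  where open ≡-Reasoning

module _ {n} {a : WeakComposition n} where

  -- Occurrences of a value can be counted column by column instead of row by row.
  wt-cong : (T U : Filling a) → (∀ c → columns T c ≗ columns U c) → wt T ≡ wt U
  wt-cong T U T≗U = tabulate-cong λ i → begin
    length (filter (_≟ row# i) (entries T))  ≡⟨ by-columns T (row# i) ⟩
    below (λ c → columns T c (row# i)) M     ≡⟨ below-cong M (λ c _ → T≗U c (row# i)) ⟩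
    below (λ c → columns U c (row# i)) M     ≡⟨ by-columns U (row# i) ⟨
    length (filter (_≟ row# i) (entries U))  ∎
    where
    open ≡-Reasoning
    M = sum (lookup a)
    by-columns : (T : Filling a) → ∀ v →
      length (filter (_≟ v) (entries T)) ≡ below (λ c → columns T c v) M
    by-columns T v = trans (length-filter-entries T v M (sum-term-≤ (lookup a)))
      (sym (below-sum (λ c r → 𝟙 ((c <? lookup a r) ×-dec (grid T r c ≟ v))) M))

-- The bijection

atomGrid-cong : ∀ {n} {C C′ : ℕ → Bag} → (∀ c → C c ≗ C′ c) →
  ∀ (r : Fin n) c → atomGrid C r c ≡ atomGrid C′ r c
atomGrid-cong {n} C≗C′ r c =
  below-cong n λ u _ → cong (λ x → 𝟙 (0 <? x)) (key-congˡ C≗C′ (suc u) 0 c (row# r))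

tableauGrid-cong : ∀ {n} (a : Fin n → ℕ) {C C′ : ℕ → Bag} → (∀ c → C c ≗ C′ c) →
  ∀ r c → tableauGrid a C r c ≡ tableauGrid a C′ r c
tableauGrid-cong {n} a C≗C′ r c with c <? a r
... | no  _ = refl
... | yes _ = below-cong (suc n) λ u _ → cong (λ x → 𝟙 (x ≤? rankInLength a (a r) r))
  (below-cong (suc u) λ v _ → cong₂ _∸_ (key-congˡ C≗C′ 1 c k v) (key-congˡ C≗C′ 1 c (suc k) v))
  where k = a r ∸ suc c

module _ {n} {a : WeakComposition n} where

  fill-cell : ∀ t r (c : Column a r) → fill a t ⟨ r , c ⟩ ≡ t r (toℕ c)
  fill-cell t r c = trans (sym (grid-cell (fill a t) r c)) (grid-fill a t r (toℕ<n c))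

  columns-fill : ∀ t c → columns (fill a t) c ≗ contents (lookup a) t c
  columns-fill t c v = #-cong
    (λ r → (c <? lookup a r) ×-dec (grid (fill a t) r c ≟ v)) (λ r → (c <? lookup a r) ×-dec (t r c ≟ v))
    (λ {r} (c<a , t≡v) → c<a , trans (sym (grid-fill a t r c<a)) t≡v)
    (λ {r} (c<a , t≡v) → c<a , trans (grid-fill a t r c<a) t≡v)

  fill-grid : ∀ t (T : Filling a) → (∀ r c → t r c ≡ grid T r c) → fill a t ≡ T
  fill-grid t T t≡T = grid-injective (fill a t) T λ r c → case c <? lookup a r of λ where
    (yes c<a) → trans (grid-fill a t r c<a) (t≡T r c)
    (no  c≮a) → trans (grid-outside (fill a t) (≮⇒≥ c≮a)) (sym (grid-outside T (≮⇒≥ c≮a)))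

  toTableau toAtom : Filling a → Filling a
  toTableau S = fill a (tableauGrid (lookup a) (columns S))
  toAtom    T = fill a (atomGrid (columns T))

  module _ {S : Filling a} (isAtom : IsAtomFilling S) where

    private
      isAtomGrid = atom⇒grid isAtom
      open BuildKey (GridContents.isContents (IsAtomGrid.isGrid isAtomGrid)
                      (AtomContents.key-shape isAtomGrid))

    toTableau-quasiKey : IsQuasiKeyTableau¹ (toTableau S)
    toTableau-quasiKey = grid⇒quasiKey (fill-cell _) isKeyGrid

    columns-toTableau : ∀ c → columns (toTableau S) c ≗ columns S c
    columns-toTableau c v = trans (columns-fill _ c v) (contents≗ c v)

    -- `toAtom` sees only the columns, which `toTableau` has preserved, and from the columns of `S`
    -- it rebuilds `S`.
    toAtom-toTableau : toAtom (toTableau S) ≡ S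
    toAtom-toTableau = fill-grid _ S λ r c →
      trans (atomGrid-cong columns-toTableau r c) (atom-canonical isAtomGrid r c)

  module _ {T : Filling a} (isKey : IsQuasiKeyTableau¹ T) where

    private
      isKeyGrid = quasiKey⇒grid isKey
      open BuildAtom (GridContents.isContents (IsKeyGrid.isGrid isKeyGrid)
                       (KeyContents.key-shape isKeyGrid))

    toAtom-atom : IsAtomFilling (toAtom T)
    toAtom-atom = grid⇒atom (fill-cell _) isAtomGrid

    columns-toAtom : ∀ c → columns (toAtom T) c ≗ columns T c
    columns-toAtom c v = trans (columns-fill _ c v) (contents≗ c v)

    toTableau-toAtom : toTableau (toAtom T) ≡ T
    toTableau-toAtom = fill-grid _ T λ r c →
      trans (tableauGrid-cong (lookup a) columns-toAtom r c) (tableau-canonical isKeyGrid r c)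

-- Transporting sums along a bijection

module _ {n} {A : Set} (w : A → Monomial n) where

  coeff-↭ : ∀ {xs ys} → xs ↭ ys → ∑ xs (λ x → x^ w x) ≈ ∑ ys (λ y → x^ w y)
  coeff-↭ ↭.refl         e = refl
  coeff-↭ (↭.prep x p)   e =
    cong (λ z → (if does (≡-dec _≟_ (w x) e) then 1ℤ else 0ℤ) ℤ.+ z) (coeff-↭ p e)
  coeff-↭ {_ ∷ _ ∷ xs} {_ ∷ _ ∷ ys} (↭.swap x y p) e = begin
    k x ℤ.+ (k y ℤ.+ coeff (∑ xs term) e)  ≡⟨ cong (λ z → k x ℤ.+ (k y ℤ.+ z)) (coeff-↭ p e) ⟩
    k x ℤ.+ (k y ℤ.+ coeff (∑ ys term) e)  ≡⟨ x∙yz≈y∙xz (k x) (k y) (coeff (∑ ys term) e) ⟩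
    k y ℤ.+ (k x ℤ.+ coeff (∑ ys term) e)  ∎
    where
    open ≡-Reasoning
    term = λ x → x^ w x
    k : A → ℤ
    k x = if does (≡-dec _≟_ (w x) e) then 1ℤ else 0ℤ
  coeff-↭ (↭.trans p q)  e = trans (coeff-↭ p e) (coeff-↭ q e)

coeff-map : ∀ {n} {A B : Set} (f : A → B) {v : A → Monomial n} {w : B → Monomial n} xs →
  (∀ {x} → x ∈ xs → w (f x) ≡ v x) → ∑ (map f xs) (λ y → x^ w y) ≈ ∑ xs (λ x → x^ v x)
coeff-map f []       w∘f≡v e = refl
coeff-map f (x ∷ xs) w∘f≡v e = cong₂ ℤ._+_
  (cong (λ m → if does (≡-dec _≟_ m e) then 1ℤ else 0ℤ) (w∘f≡v (here refl)))
  (coeff-map f xs (w∘f≡v ∘ there) e)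

module _ {A : Set} {P Q : Pred A 0ℓ} (p : Enumeration P) (q : Enumeration Q) (f g : A → A)
  (f-Q : ∀ {x} → P x → Q (f x)) (g-P : ∀ {y} → Q y → P (g y))
  (g∘f : ∀ {x} → P x → g (f x) ≡ x) (f∘g : ∀ {y} → Q y → f (g y) ≡ y) where

  open Enumeration

  map-elements-↭ : map f (elements p) ↭ elements q
  map-elements-↭ = ∼bag⇒↭ (unique∧set⇒bag map-unique (unique q) (mk⇔ to from′))
    where
    map-unique : Unique (map f (elements p))
    -- A list is duplicate-free if its image under `g` is, and here that image is the list of
    -- elements of `p`.
    map-unique = Unique.map⁻ (subst Unique
      (sym (trans (sym (map-∘ {g = g} {f = f} (elements p))) (map-id-local (Listᵃ.tabulate (g∘f ∘ sound p))))) (unique p))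
    to : ∀ {y} → y ∈ map f (elements p) → y ∈ elements q
    to y∈ with x , x∈ , refl ← ∈-map⁻ f y∈ = complete q (f-Q (sound p x∈))
    from′ : ∀ {y} → y ∈ elements q → y ∈ map f (elements p)
    from′ {y} y∈ = subst (_∈ map f (elements p)) (f∘g (sound q y∈))
      (∈-map⁺ f (complete p (g-P (sound q y∈))))

  ∑-bijection : ∀ {n} (w : A → Monomial n) → (∀ {x} → P x → w (f x) ≡ w x) →
    ∑ (elements p) (λ x → x^ w x) ≈ ∑ (elements q) (λ y → x^ w y)
  ∑-bijection w w-f e = trans (sym (coeff-map f (elements p) (w-f ∘ sound p) e))
    (coeff-↭ w map-elements-↭ e)

theorem3p6 : ∀ {n : ℕ} (a : WeakComposition n) → 𝒜 a ≈ 𝔔¹ a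
theorem3p6 a = ∑-bijection (atomFillings a) (quasiKeyTableaux¹ a) toTableau toAtom
  toTableau-quasiKey toAtom-atom toAtom-toTableau toTableau-toAtom
  wt λ {S} isAtom → wt-cong (toTableau S) S (columns-toTableau isAtom)
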